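{- Let $p$ be a prime, $N=p^e$ with $e\ge1$, let $h\ge1$ be a divisor of $N-1$, put $A=(N-1)/h$ and $\Lambda_{N,h}(U)=U(U^A-1)^h\in\mathbb F_p[U]$. Let $Q=p^m$ with $m\ge1$ and put $s=p^{\gcd(e,m)}$, $C=(N-1)/(s-1)$, $\kappa=\gcd(h,C)$. For $t\in\mathbb F_Q$ let $r_Q(t)=\#\{u\in\mathbb F_Q:\Lambda_{N,h}(u)=t\}$, and define the fibre enumerator $\mathcal E_{N,h,Q}(Z)=\sum_{t\in\mathbb F_Q}Z^{r_Q(t)}$. Put $$M_0(Q)=\frac{\kappa(s-1)Q}{hs},\qquad M_1(Q)=\frac{(h-\kappa)(Q-1)}{h},\qquad M_s(Q)=\frac{\kappa(Q-s)}{hs}.$$ Then $$\mathcal E_{N,h,Q}(Z)=Z^{1+\kappa(s-1)/h}+M_0(Q)+M_1(Q)Z+M_s(Q)Z^s.$$ Consequently $$\#\Lambda_{N,h}(\mathbb F_Q)=Q-M_0(Q)=Q\left(1-\frac{\kappa(s-1)}{hs}\right),$$ and for every fixed integer $a\ge1$, $$\sum_{t\in\mathbb F_Q}r_Q(t)^a=\left(1+\frac{\kappa(s-1)}h\right)^a+\frac{(h-\kappa)(Q-1)}h+s^{a-1}\,\frac{\kappa(Q-s)}h.$$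
   Context: Fibres are counted as sets of $\mathbb F_Q$-rational points, without multiplicity. $\Lambda_{N,h}(\mathbb F_Q)$ denotes the value set (image) of $u\mapsto\Lambda_{N,h}(u)$ on $\mathbb F_Q$. The number $C$ is an integer because $s-1\mid N-1$. -}

module Defs where

open import Algebra.Bundles using (CommutativeRing)
import Algebra.Properties.Semiring.Exp as SemiringExp
open import Data.Fin.Base using (Fin)
import Data.Fin.Properties as Fin
open import Data.Integer.Base using (+_)
import Data.Integer.Base as ℤ
open import Data.List.Base using (List; []; _∷_; _++_; allFin; filter; foldr; length; map; replicate)
open import Data.Nat.Base hiding (_⊔_)
open import Data.Nat.Divisibility
open import Data.Nat.DivMod using (_/_; m*[n/m]≡n)
open import Data.Nat.GCD
open import Data.Nat.Primality using (Prime; prime⇒nonZero; prime⇒nonTrivial)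
open import Data.Nat.Properties hiding (_≟_)
open import Data.Product.Base using (∃; _,_)
open import Data.Rational.Base as ℚ using (ℚ; 0ℚ; 1ℚ)
open import Function.Bundles using (Inverse)
open import Level using (Level; _⊔_) renaming (suc to lsuc)
open import Relation.Binary.Definitions using (Decidable)
open import Relation.Binary.PropositionalEquality as ≡ using (_≡_; cong; cong₂; subst; sym; trans)
open import Relation.Nullary using (¬_)
open import Relation.Nullary.Decidable using (map′)
import Relation.Unary as U

record Field c ℓ : Set (lsuc (c ⊔ ℓ)) where
  field
    commutativeRing : CommutativeRing c ℓ

  open CommutativeRing commutativeRing public
    renaming (_+_ to _+ᶠ_; _*_ to _*ᶠ_; _-_ to _-ᶠ_; refl to ≈-refl; sym to ≈-sym; trans to ≈-trans)

  field
    1≉0        : ¬ (1# ≈ 0#)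
    invertible : ∀ x → ¬ (x ≈ 0#) → ∃ λ y → x *ᶠ y ≈ 1#

-- A field with exactly q elements up to its equality _≈_. When q is a power
-- of a prime p, the characteristic is p automatically.

record FiniteField c ℓ (q : ℕ) : Set (lsuc (c ⊔ ℓ)) where
  field
    underlyingField : Field c ℓ

  open Field underlyingField public

  field
    enumeration : Inverse setoid (≡.setoid (Fin q))

  private module E = Inverse enumeration

  -- Every element of the field, once each up to _≈_.
  elements : List Carrier
  elements = map E.from (allFin q)

  _≟_ : Decidable _≈_
  x ≟ y = map′
    (λ eq → ≈-trans (≈-sym (E.strictlyInverseʳ x)) (≈-trans (E.from-cong eq) (E.strictlyInverseʳ y)))
    E.to-cong
    (E.to x Fin.≟ E.to y)

  # : ∀ {a} {P : U.Pred Carrier a} → U.Decidable P → ℕ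
  # P? = length (filter P? elements)

  open SemiringExp semiring public
    using () renaming (_^_ to _^ᶠ_)

-- ℚ[Z], as coefficient lists with the constant coefficient first; lists
-- differing by trailing zeros denote the same polynomial.

Poly : Set
Poly = List ℚ

coeff : Poly → ℕ → ℚ
coeff []      _       = 0ℚ
coeff (x ∷ f) zero    = x
coeff (x ∷ f) (suc k) = coeff f k

infix  4 _≈ᴾ_
infixl 6 _+ᴾ_
infix  7 _·Z^_

_≈ᴾ_ : Poly → Poly → Set
f ≈ᴾ g = ∀ k → coeff f k ≡ coeff g k

_+ᴾ_ : Poly → Poly → Poly
[]      +ᴾ g       = g
(x ∷ f) +ᴾ []      = x ∷ f
(x ∷ f) +ᴾ (y ∷ g) = (x ℚ.+ y) ∷ (f +ᴾ g)

_·Z^_ : ℚ → ℕ → Poly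
c ·Z^ n = replicate n 0ℚ ++ (c ∷ [])

sumᴾ : List Poly → Poly
sumᴾ = foldr _+ᴾ_ []

fromℕ : ℕ → ℚ
fromℕ n = + n ℚ./ 1

x-1∣x^n-1 : ∀ x .{{_ : NonZero x}} n → x ∸ 1 ∣ x ^ n ∸ 1
x-1∣x^n-1 x zero    = (x ∸ 1) ∣0
x-1∣x^n-1 x (suc n) = subst (x ∸ 1 ∣_) (sym eq)
  (∣m∣n⇒∣m+n (n∣m*n (x ^ n)) (x-1∣x^n-1 x n))
  where
  open ≡.≡-Reasoning
  eq : x * x ^ n ∸ 1 ≡ x ^ n * (x ∸ 1) + (x ^ n ∸ 1)
  eq = begin
    x * x ^ n ∸ 1                     ≡⟨ cong (λ y → y * x ^ n ∸ 1) (sym (m∸n+n≡m (>-nonZero⁻¹ x))) ⟩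
    (x ∸ 1 + 1) * x ^ n ∸ 1           ≡⟨ cong (_∸ 1) (*-distribʳ-+ (x ^ n) (x ∸ 1) 1) ⟩
    (x ∸ 1) * x ^ n + 1 * x ^ n ∸ 1   ≡⟨ cong₂ (λ y z → y + z ∸ 1) (*-comm (x ∸ 1) (x ^ n)) (*-identityˡ (x ^ n)) ⟩
    x ^ n * (x ∸ 1) + x ^ n ∸ 1       ≡⟨ +-∸-assoc (x ^ n * (x ∸ 1)) (m^n>0 x n) ⟩
    x ^ n * (x ∸ 1) + (x ^ n ∸ 1)     ∎

module Parameters
  (p e h m : ℕ) (p-prime : Prime p) (1≤e : 1 ≤ e) (1≤h : 1 ≤ h) (h∣pᵉ-1 : h ∣ p ^ e ∸ 1)
  where

  N Q s : ℕ
  N = p ^ e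
  Q = p ^ m
  s = p ^ gcd e m

  p≢0 : NonZero p
  p≢0 = prime⇒nonZero p-prime

  h≢0 : NonZero h
  h≢0 = >-nonZero 1≤h

  s≢0 : NonZero s
  s≢0 = m^n≢0 p (gcd e m) {{p≢0}}

  1<s : 1 < s
  1<s = begin-strict
    1             <⟨ nonTrivial⇒n>1 p {{prime⇒nonTrivial p-prime}} ⟩
    p             ≡⟨ sym (^-identityʳ p) ⟩
    p ^ 1         ≤⟨ ^-monoʳ-≤ p {{p≢0}} (>-nonZero⁻¹ (gcd e m) {{gcd[e,m]≢0}}) ⟩
    p ^ gcd e m   ∎
    where
    open ≤-Reasoning
    gcd[e,m]≢0 : NonZero (gcd e m)
    gcd[e,m]≢0 = ≢-nonZero λ eq → m<n⇒n≢0 1≤e (gcd[m,n]≡0⇒m≡0 eq)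

  s-1≢0 : NonZero (s ∸ 1)
  s-1≢0 = >-nonZero (m<n⇒0<n∸m 1<s)

  hs≢0 : NonZero (h * s)
  hs≢0 = m*n≢0 h s {{h≢0}} {{s≢0}}

  s-1∣N-1 : s ∸ 1 ∣ N ∸ 1
  s-1∣N-1 with gcd[m,n]∣m e m
  ... | divides k e≡k*g = subst (λ y → s ∸ 1 ∣ y ∸ 1) s^k≡N (x-1∣x^n-1 s {{s≢0}} k)
    where
    s^k≡N : s ^ k ≡ N
    s^k≡N = trans (^-*-assoc p (gcd e m) k)
                  (cong (p ^_) (trans (*-comm (gcd e m) k) (sym e≡k*g)))

  -- The divisions in A and C are exact, by h∣pᵉ-1 and s-1∣N-1.
  A C κ : ℕ
  A = _/_ (N ∸ 1) h {{h≢0}}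
  C = _/_ (N ∸ 1) (s ∸ 1) {{s-1≢0}}
  κ = gcd h C

  -- The natural number κ(s-1)/h; the division is exact by the next lemma.
  ρ : ℕ
  ρ = _/_ (κ * (s ∸ 1)) h {{h≢0}}

  h∣κ[s-1] : h ∣ κ * (s ∸ 1)
  h∣κ[s-1] = subst (h ∣_) (sym eq) (gcd-greatest (n∣m*n (s ∸ 1)) h∣pᵉ-1)
    where
    eq : κ * (s ∸ 1) ≡ gcd ((s ∸ 1) * h) (N ∸ 1)
    eq = trans (*-comm κ (s ∸ 1))
        (trans (c*gcd[m,n]≡gcd[cm,cn] (s ∸ 1) h C)
               (cong (gcd ((s ∸ 1) * h)) (m*[n/m]≡n {{s-1≢0}} s-1∣N-1)))

  M₀ M₁ Mₛ : ℚ
  M₀ = ℚ._/_ (+ (κ * (s ∸ 1) * Q)) (h * s) {{hs≢0}}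
  M₁ = ℚ._/_ ((+ h ℤ.- + κ) ℤ.* (+ Q ℤ.- + 1)) h {{h≢0}}
  Mₛ = ℚ._/_ (+ κ ℤ.* (+ Q ℤ.- + s)) (h * s) {{hs≢0}}

  module Fibres {c ℓ} (F : FiniteField c ℓ Q) where

    open FiniteField F public using (Carrier; _≈_; _≟_; #; elements)
    open FiniteField F using (1#; _*ᶠ_; _-ᶠ_; _^ᶠ_; enumeration)
    private module R = FiniteField F
    open SemiringExp R.semiring using (^-congˡ)

    -- The evaluation map on F of the polynomial U(U^A - 1)^h.  Only the values
    -- of this polynomial on F enter into the fibre counts and the image.
    Λ : Carrier → Carrier
    Λ u = u *ᶠ ((u ^ᶠ A) -ᶠ 1#) ^ᶠ h

    r : Carrier → ℕ
    r t = # (λ u → Λ u ≟ t)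

    InImage : Carrier → Set (c ⊔ ℓ)
    InImage t = ∃ λ u → Λ u ≈ t

    inImage? : U.Decidable InImage
    inImage? t = map′
      (λ { (i , eq) → Inverse.from enumeration i , eq })
      (λ { (u , eq) → Inverse.to enumeration u ,
                      R.≈-trans (Λ-cong (Inverse.strictlyInverseʳ enumeration u)) eq })
      (Fin.any? λ i → Λ (Inverse.from enumeration i) ≟ t)
      where
      Λ-cong : ∀ {u v} → u ≈ v → Λ u ≈ Λ v
      Λ-cong eq = R.*-cong eq (^-congˡ h (R.+-cong (^-congˡ A eq) R.≈-refl))

    𝓔 : Poly
    𝓔 = sumᴾ (map (λ t → 1ℚ ·Z^ r t) elements)

{-# OPTIONS --safe #-}
module Submission where

-- For t ≠ 0 the substitution v = 1 / (u^A - 1), u = t v^h identifies the fibre of Λ over t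
-- with the fibre over 1 of the additive map v ↦ t^A v^N - v. A fibre of an additive map is
-- empty or a coset of the kernel, and this kernel consists of 0 and the w with t^A w^(N-1) = 1,
-- of which there are none or gcd(N-1, Q-1) = s-1. A trivial kernel makes the map bijective, so
-- fibres over t ≠ 0 have size 0, 1 or s. Counting the pairs (t, w) by w instead gives
-- (Q-1) gcd(A, Q-1) of them, with gcd(A, Q-1) = κ(s-1)/h, and this together with the number
-- of points t and the total size of the fibres determines how often each size occurs.

open import Defs
open import Data.Nat.Base
open import Data.Nat.Divisibility using (_∣_)
open import Data.Nat.ListAction using (sum)
open import Data.Nat.Primality using (Prime)
open import Data.Integer.Base as ℤ using (+_)
open import Data.Rational.Base as ℚ using (1ℚ)
open import Data.List.Base using (map)
open import Data.Product.Base using (_×_)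
open import Relation.Binary.PropositionalEquality using (_≡_)

open import Algebra.Bundles using (CommutativeMonoid)
import Algebra.Properties.CommutativeMonoid.Sum as MonoidSum
import Algebra.Properties.CommutativeSemiring.Binomial as Binomial
import Algebra.Properties.CommutativeSemiring.Exp as Exp
import Algebra.Properties.Group as GroupProperties
import Algebra.Properties.Ring as RingProperties
import Algebra.Properties.Semiring.Mult as Mult
import Algebra.Properties.Semiring.Sum as SemiringSum
import Algebra.Solver.Ring.NaturalCoefficients.Default as SemiringSolver
open import Data.Bool.Base using (if_then_else_)
open import Data.Fin.Base using (Fin; zero; suc; toℕ; inject₁) renaming (fromℕ to fromℕᶠ)
open import Data.Fin.Permutation using (Permutation′; permutation)
import Data.Fin.Properties as Fin
import Data.Integer.Properties as ℤ
open import Data.List.Base using ([]; _∷_; filter; length; tabulate)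
open import Data.List.Relation.Unary.All as All using (All; []; _∷_)
import Data.List.Relation.Unary.All.Properties as All
open import Data.List.Relation.Unary.AllPairs using (AllPairs; []; _∷_)
import Data.List.Relation.Unary.AllPairs.Properties as AllPairs
open import Data.Nat.Combinatorics using (_C_; nCn≡1; nC1≡n; k>n⇒nCk≡0; nCk+nC[k+1]≡[n+1]C[k+1])
open import Data.Nat.Divisibility
open import Data.Nat.DivMod using (m/n*n≡m; m*[n/m]≡n)
open import Data.Nat.GCD
open import Data.Nat.Primality using (euclidsLemma; ¬prime[0])
import Data.Nat.Properties as ℕ
open import Data.Nat.Solver using (module +-*-Solver)
open import Data.Product.Base using (_,_; ∃; proj₁; proj₂)
open import Data.Rational.Base using (ℚ; 0ℚ)
import Data.Rational.Properties as ℚ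
open import Data.Rational.Unnormalised.Base as ℚᵘ using (mkℚᵘ; *≡*)
import Data.Rational.Unnormalised.Properties as ℚᵘ
open import Data.Sum.Base using (_⊎_; inj₁; inj₂)
open import Data.Unit.Base using (⊤; tt)
open import Function.Base using (_∘_; id; case_of_)
open import Function.Bundles using (Inverse)
open import Level using (Level)
open import Relation.Binary.Definitions using (_Respects_)
open import Relation.Binary.PropositionalEquality
  using (refl; sym; trans; cong; cong₂; subst; subst₂; module ≡-Reasoning)
import Relation.Binary.Reasoning.Setoid as SetoidReasoning
open import Relation.Nullary using (¬_; Dec; yes; no; does; contradiction; _×-dec_; ¬?)
open import Relation.Nullary.Decidable using (dec-true; dec-false)
open import Relation.Unary as U using (Pred)

-- The substitution linearises the equation because h A = N - 1: raising u = t v^h to the power A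
-- gives t^A v^(N-1), so the requirement (u^A - 1) v = 1 reads t^A v^N - v = 1, and v^N is additive
-- since N is a power of the characteristic. When the kernel is nontrivial, the fibre over t is
-- empty or full according to whether 1 lies in the image of the additive map. This is never decided
-- by a formula in t: the numbers of points of the three types are unknowns in three linear
-- equations. The pairs (t, w) are counted by w because the answer is then uniform: each nonzero w
-- admits the solution t = w^(-h), whereas a given t may admit no w at all. The resulting gcd(A,
-- Q-1) also governs the fibre over 0, where u = 0 or u^A = 1. Roots of unity are counted without a
-- primitive element, by a degree bound from above and a pigeonhole argument on a power map from
-- below.

private module ℕ∑ = SemiringSum ℕ.+-*-semiring
open ℕ∑ using () renaming (sum to sumᵛ)

private variable
  a b : Level

-- Indicators and finite sums of natural numbers

ind : {P : Set a} → Dec P → ℕ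
ind P? = if does P? then 1 else 0

module _ {P : Set a} where

  ind-yes : (P? : Dec P) → P → ind P? ≡ 1
  ind-yes (yes _)  _ = refl
  ind-yes (no ¬p) p = contradiction p ¬p

  ind-no : (P? : Dec P) → ¬ P → ind P? ≡ 0
  ind-no (yes p) ¬p = contradiction p ¬p
  ind-no (no _)  _  = refl

ind-⊎ : ∀ {c} {P : Set a} {R : Set b} {S : Set c} (P? : Dec P) (R? : Dec R) (S? : Dec S) →
  (P → S) → (R → S) → (S → P ⊎ R) → (P → ¬ R) → ind S? ≡ ind P? + ind R?
ind-⊎ (yes p) R? S? P⇒S _ _ disjoint = trans (ind-yes S? (P⇒S p)) (cong suc (sym (ind-no R? (disjoint p))))
ind-⊎ (no _) (yes r) S? _ R⇒S _ _ = ind-yes S? (R⇒S r)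
ind-⊎ (no ¬p) (no ¬r) S? _ _ S⇒P⊎R _ = ind-no S? λ s → case S⇒P⊎R s of λ where
  (inj₁ p) → ¬p p
  (inj₂ r) → ¬r r

≤-*-ind : {P : Set a} (P? : Dec P) → ∀ {n k} → (P → n ≤ k) → (¬ P → n ≡ 0) → n ≤ k * ind P?
≤-*-ind (yes p) {k = k} ≤k _ = ℕ.≤-trans (≤k p) (ℕ.≤-reflexive (sym (ℕ.*-identityʳ k)))
≤-*-ind (no ¬p) _ ≡0 = ℕ.≤-trans (ℕ.≤-reflexive (≡0 ¬p)) z≤n

ind-mono : {P : Set a} {R : Set b} (P? : Dec P) (R? : Dec R) → (P → R) → ind P? ≤ ind R?
ind-mono (yes p) R? f = ℕ.≤-reflexive (sym (ind-yes R? (f p)))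
ind-mono (no _)  R? f = z≤n

ind-× : {P : Set a} {R : Set b} (P? : Dec P) (R? : Dec R) → ind (P? ×-dec R?) ≡ ind P? * ind R?
ind-× (yes _) (yes _) = refl
ind-× (yes _) (no _)  = refl
ind-× (no _)  R?      = refl

sum-mono-≤ : ∀ {n} {f g : Fin n → ℕ} → (∀ i → f i ≤ g i) → sumᵛ f ≤ sumᵛ g
sum-mono-≤ {zero}  f≤g = z≤n
sum-mono-≤ {suc n} f≤g = ℕ.+-mono-≤ (f≤g zero) (sum-mono-≤ (f≤g ∘ suc))

sum-const : ∀ n k → sumᵛ {n} (λ _ → k) ≡ n * k
sum-const zero    k = refl
sum-const (suc n) k = cong (λ n → k + n) (sum-const n k)

sum-ind-≟ : ∀ {n} (i : Fin n) → sumᵛ (λ j → ind (i Fin.≟ j)) ≡ 1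
sum-ind-≟ {suc n} zero    = cong suc (trans (sum-const n 0) (ℕ.*-zeroʳ n))
sum-ind-≟ {suc n} (suc i) = sum-ind-≟ i

-- Pigeonhole without slack: if one term were 0, the other n - 1 terms, each at most 1, could not
-- reach n. This is what makes an injective self-map of the field bijective.
≤1∧n≤sum⇒≡1 : ∀ {n} {f : Fin n → ℕ} → (∀ i → f i ≤ 1) → n ≤ sumᵛ f → ∀ i → f i ≡ 1
≤1∧n≤sum⇒≡1 {suc n} {f} f≤1 n≤sum zero = ℕ.≤-antisym (f≤1 zero)
  (ℕ.+-cancelʳ-≤ n 1 (f zero) (ℕ.≤-trans n≤sum (ℕ.+-monoʳ-≤ (f zero) rest≤n)))
  where
  rest≤n : sumᵛ (f ∘ suc) ≤ n
  rest≤n = ℕ.≤-trans (sum-mono-≤ (f≤1 ∘ suc)) (ℕ.≤-reflexive (trans (sum-const n 1) (ℕ.*-identityʳ n)))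
≤1∧n≤sum⇒≡1 {suc n} f≤1 n≤sum (suc i) = ≤1∧n≤sum⇒≡1 (f≤1 ∘ suc)
  (ℕ.+-cancelˡ-≤ 1 n _ (ℕ.≤-trans n≤sum (ℕ.+-monoˡ-≤ _ (f≤1 zero)))) i

length-filter : ∀ {A : Set a} {P : Pred A b} (P? : U.Decidable P) xs →
  length (filter P? xs) ≡ sum (map (ind ∘ P?) xs)
length-filter P? [] = refl
length-filter P? (x ∷ xs) with P? x
... | yes _ = cong suc (length-filter P? xs)
... | no _  = length-filter P? xs

-- Binomial coefficients modulo a prime, and gcds of numbers x^m - 1

[k+1]*[n+1]C[k+1]≡[n+1]*nCk : ∀ n k → suc k * (suc n C suc k) ≡ suc n * (n C k)
[k+1]*[n+1]C[k+1]≡[n+1]*nCk zero zero = refl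
[k+1]*[n+1]C[k+1]≡[n+1]*nCk zero (suc k) = begin
  suc (suc k) * (1 C suc (suc k)) ≡⟨ cong (suc (suc k) *_) (k>n⇒nCk≡0 {1} {suc (suc k)} (s<s z<s)) ⟩
  suc (suc k) * 0                 ≡⟨ ℕ.*-zeroʳ (suc (suc k)) ⟩
  0                               ≡⟨ cong (1 *_) (k>n⇒nCk≡0 {0} {suc k} z<s) ⟨
  1 * (0 C suc k)                 ∎
  where open ≡-Reasoning
[k+1]*[n+1]C[k+1]≡[n+1]*nCk (suc n) zero =
  trans (ℕ.*-identityˡ _) (trans (nC1≡n (suc (suc n))) (sym (ℕ.*-identityʳ (suc (suc n)))))
[k+1]*[n+1]C[k+1]≡[n+1]*nCk (suc n) (suc k) = begin
  suc (suc k) * (suc (suc n) C suc (suc k))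
    ≡⟨ cong (suc (suc k) *_) (nCk+nC[k+1]≡[n+1]C[k+1] (suc n) (suc k)) ⟨
  suc (suc k) * (u + v)
    ≡⟨ solve 3 (λ k u v → (con 2 :+ k) :* (u :+ v) := u :+ ((con 1 :+ k) :* u :+ (con 2 :+ k) :* v)) refl k u v ⟩
  u + (suc k * u + suc (suc k) * v)
    ≡⟨ cong (λ n → u + n) (cong₂ _+_ ([k+1]*[n+1]C[k+1]≡[n+1]*nCk n k) ([k+1]*[n+1]C[k+1]≡[n+1]*nCk n (suc k))) ⟩
  u + (suc n * (n C k) + suc n * (n C suc k))
    ≡⟨ cong (λ n → u + n) (trans (sym (ℕ.*-distribˡ-+ (suc n) (n C k) (n C suc k))) (cong (suc n *_) (nCk+nC[k+1]≡[n+1]C[k+1] n k))) ⟩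
  suc (suc n) * u ∎
  where
  open ≡-Reasoning
  open +-*-Solver using (solve; _:+_; _:*_; _:=_; con)
  u = suc n C suc k
  v = suc n C suc (suc k)

-- By the absorption identity p divides the product of `k` and the binomial coefficient, and p
-- cannot divide `k`, which is positive and smaller than p.
prime∣pCk : ∀ {p k} → Prime p → 0 < k → k < p → p ∣ p C k
prime∣pCk {suc p} {suc k} p-prime _ k<p
  with euclidsLemma (suc k) (suc p C suc k) p-prime
         (subst (suc p ∣_) (sym ([k+1]*[n+1]C[k+1]≡[n+1]*nCk p k)) (m∣m*n (p C k)))
... | inj₁ p∣k = contradiction k<p (ℕ.≤⇒≯ (∣⇒≤ p∣k))
... | inj₂ p∣C = p∣C

-- The Euclidean step on exponents, written as a sum: a common divisor of the total and of x^b - 1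
-- must divide the remaining summand x^a - 1.
x^a*[x^b∸1]+[x^a∸1]≡x^[a+b]∸1 : ∀ x .{{_ : NonZero x}} a b → x ^ a * (x ^ b ∸ 1) + (x ^ a ∸ 1) ≡ x ^ (a + b) ∸ 1
x^a*[x^b∸1]+[x^a∸1]≡x^[a+b]∸1 x a b = begin
  x ^ a * (x ^ b ∸ 1) + (x ^ a ∸ 1) ≡⟨ ℕ.+-∸-assoc (x ^ a * (x ^ b ∸ 1)) (ℕ.m^n>0 x a) ⟨
  x ^ a * (x ^ b ∸ 1) + x ^ a ∸ 1
    ≡⟨ cong (_∸ 1) (trans (ℕ.+-comm _ (x ^ a)) (sym (ℕ.*-suc (x ^ a) (x ^ b ∸ 1)))) ⟩
  x ^ a * suc (x ^ b ∸ 1) ∸ 1       ≡⟨ cong (λ y → x ^ a * y ∸ 1) (ℕ.m+[n∸m]≡n (ℕ.m^n>0 x b)) ⟩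
  x ^ a * x ^ b ∸ 1                 ≡⟨ cong (_∸ 1) (ℕ.^-distribˡ-+-* x a b) ⟨
  x ^ (a + b) ∸ 1                   ∎
  where open ≡-Reasoning

x^m∸1∣x^n∸1 : ∀ x .{{_ : NonZero x}} {m n} → m ∣ n → x ^ m ∸ 1 ∣ x ^ n ∸ 1
x^m∸1∣x^n∸1 x {m} (divides k refl) =
  subst (λ y → x ^ m ∸ 1 ∣ y ∸ 1) (trans (ℕ.^-*-assoc x m k) (cong (x ^_) (ℕ.*-comm m k)))
    (x-1∣x^n-1 (x ^ m) {{ℕ.m^n≢0 x m}} k)

-- Over the natural numbers Bézout's identity reads g + b n = a m or g + a m = b n. In either case
-- the Euclidean step splits x^g - 1 off from two multiples of d.
∣x^m∸1∣x^n∸1⇒∣x^gcd∸1 : ∀ x .{{_ : NonZero x}} m n {d} →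
  d ∣ x ^ m ∸ 1 → d ∣ x ^ n ∸ 1 → d ∣ x ^ gcd m n ∸ 1
∣x^m∸1∣x^n∸1⇒∣x^gcd∸1 x m n {d} d∣m d∣n with Bézout.identity (gcd-GCD m n)
... | Bézout.+- a b eq = ∣m+n∣m⇒∣n
  (subst (d ∣_) (sym (trans (x^a*[x^b∸1]+[x^a∸1]≡x^[a+b]∸1 x (gcd m n) (b * n)) (cong (λ y → x ^ y ∸ 1) eq)))
    (∣-trans d∣m (x^m∸1∣x^n∸1 x (n∣m*n a))))
  (∣n⇒∣m*n (x ^ gcd m n) (∣-trans d∣n (x^m∸1∣x^n∸1 x (n∣m*n b))))
... | Bézout.-+ a b eq = ∣m+n∣m⇒∣n
  (subst (d ∣_) (sym (trans (x^a*[x^b∸1]+[x^a∸1]≡x^[a+b]∸1 x (gcd m n) (a * m)) (cong (λ y → x ^ y ∸ 1) eq)))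
    (∣-trans d∣n (x^m∸1∣x^n∸1 x (n∣m*n b))))
  (∣n⇒∣m*n (x ^ gcd m n) (∣-trans d∣m (x^m∸1∣x^n∸1 x (n∣m*n a))))

gcd[x^m∸1,x^n∸1]≡x^gcd∸1 : ∀ x .{{_ : NonZero x}} m n →
  gcd (x ^ m ∸ 1) (x ^ n ∸ 1) ≡ x ^ gcd m n ∸ 1
gcd[x^m∸1,x^n∸1]≡x^gcd∸1 x m n = ∣-antisym
  (∣x^m∸1∣x^n∸1⇒∣x^gcd∸1 x m n (gcd[m,n]∣m (x ^ m ∸ 1) _) (gcd[m,n]∣n (x ^ m ∸ 1) _))
  (gcd-greatest (x^m∸1∣x^n∸1 x (gcd[m,n]∣m m n)) (x^m∸1∣x^n∸1 x (gcd[m,n]∣n m n)))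

-- Counting elements of a finite field

module Counting {c ℓ q} (F : FiniteField c ℓ q) where

  open FiniteField F using (Carrier; _≈_; ≈-sym; ≈-trans; _≟_; enumeration; elements; #)
  private module E = Inverse enumeration

  private variable
    P R : Pred Carrier a

  -- Opaque, so that a summand can be inferred from its sum.
  opaque
    ∑ : (Carrier → ℕ) → ℕ
    ∑ f = sumᵛ (f ∘ E.from)

    sum-elements : (f : Carrier → ℕ) → sum (map f elements) ≡ ∑ f
    sum-elements f = go id
      where
      go : ∀ {n} (g : Fin n → Fin q) → sum (map f (map E.from (tabulate g))) ≡ sumᵛ (f ∘ E.from ∘ g)
      go {zero}  g = refl
      go {suc n} g = cong (λ n → f (E.from (g zero)) + n) (go (g ∘ suc))

    ∑≡sum : (f : Carrier → ℕ) → ∑ f ≡ sumᵛ (f ∘ E.from)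
    ∑≡sum f = refl

  #≡∑ : (P? : U.Decidable P) → # P? ≡ ∑ (ind ∘ P?)
  #≡∑ P? = trans (length-filter P? elements) (sum-elements (ind ∘ P?))

  opaque
    unfolding ∑

    ∑-cong : ∀ {f g} → (∀ x → f x ≡ g x) → ∑ f ≡ ∑ g
    ∑-cong f≗g = ℕ∑.sum-cong-≗ (f≗g ∘ E.from)

    ∑-mono-≤ : ∀ {f g} → (∀ x → f x ≤ g x) → ∑ f ≤ ∑ g
    ∑-mono-≤ f≤g = sum-mono-≤ (f≤g ∘ E.from)

    ∑-+ : ∀ f g → ∑ (λ x → f x + g x) ≡ ∑ f + ∑ g
    ∑-+ f g = ℕ∑.∑-distrib-+ (f ∘ E.from) (g ∘ E.from)

    ∑-*ʳ : ∀ f k → ∑ (λ x → f x * k) ≡ ∑ f * k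
    ∑-*ʳ f k = sym (ℕ∑.*-distribʳ-sum k (f ∘ E.from))

    ∑-*ˡ : ∀ k f → ∑ (λ x → k * f x) ≡ k * ∑ f
    ∑-*ˡ k f = sym (ℕ∑.*-distribˡ-sum k (f ∘ E.from))

    ∑-const : ∀ k → ∑ (λ _ → k) ≡ q * k
    ∑-const k = sum-const q k

    ∑-swap : (f : Carrier → Carrier → ℕ) → ∑ (λ x → ∑ (f x)) ≡ ∑ (λ y → ∑ (λ x → f x y))
    ∑-swap f = ℕ∑.∑-comm {q} {q} (λ i j → f (E.from i) (E.from j))

    -- _≟_ is decided by comparing indices, so the indicator only depends on those.
    ∑-ind-≟ : ∀ x → ∑ (λ y → ind (x ≟ y)) ≡ 1
    ∑-ind-≟ x = trans (ℕ∑.sum-cong-≗ eq) (sum-ind-≟ (E.to x))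
      where
      eq : ∀ j → ind (x ≟ E.from j) ≡ ind (E.to x Fin.≟ j)
      eq j rewrite E.strictlyInverseˡ j = refl

  #-mono : (P? : U.Decidable P) (R? : U.Decidable R) → (∀ x → P x → R x) → # P? ≤ # R?
  #-mono P? R? P⊆R rewrite #≡∑ P? | #≡∑ R? = ∑-mono-≤ λ x → ind-mono (P? x) (R? x) (P⊆R x)

  #-cong : (P? : U.Decidable P) (R? : U.Decidable R) →
    (∀ x → P x → R x) → (∀ x → R x → P x) → # P? ≡ # R?
  #-cong P? R? P⊆R R⊆P = ℕ.≤-antisym (#-mono P? R? P⊆R) (#-mono R? P? R⊆P)

  #-⊎ : {S : Pred Carrier a} (P? : U.Decidable P) (R? : U.Decidable R) (S? : U.Decidable S) →
    (∀ {x} → P x → S x) → (∀ {x} → R x → S x) → (∀ {x} → S x → P x ⊎ R x) → (∀ {x} → P x → ¬ R x) →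
    # S? ≡ # P? + # R?
  #-⊎ P? R? S? P⊆S R⊆S S⊆P⊎R disjoint = begin
    # S?                                ≡⟨ #≡∑ S? ⟩
    ∑ (ind ∘ S?)                        ≡⟨ ∑-cong (λ x → ind-⊎ (P? x) (R? x) (S? x) P⊆S R⊆S S⊆P⊎R disjoint) ⟩
    ∑ (λ x → ind (P? x) + ind (R? x))   ≡⟨ ∑-+ (ind ∘ P?) (ind ∘ R?) ⟩
    ∑ (ind ∘ P?) + ∑ (ind ∘ R?)         ≡⟨ cong₂ _+_ (#≡∑ P?) (#≡∑ R?) ⟨
    # P? + # R?                         ∎
    where open ≡-Reasoning

  #-∅ : (P? : U.Decidable P) → (∀ x → ¬ P x) → # P? ≡ 0
  #-∅ P? ¬P = trans (#≡∑ P?) (trans (∑-cong λ x → ind-no (P? x) (¬P x)) (trans (∑-const 0) (ℕ.*-zeroʳ q)))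

  #-singleton : ∀ x → # (x ≟_) ≡ 1
  #-singleton x = trans (#≡∑ (x ≟_)) (∑-ind-≟ x)

  -- The search visits only the representatives `E.from i`; respecting `≈` carries a negative
  -- outcome over to arbitrary elements.
  find : (P? : U.Decidable P) → P Respects _≈_ → Dec (∃ P)
  find {P = P} P? resp with Fin.any? (P? ∘ E.from)
  ... | yes (i , Pi) = yes (E.from i , Pi)
  ... | no ¬P        = no λ (x , Px) → ¬P (E.to x , resp (≈-sym (E.strictlyInverseʳ x)) Px)

  opaque
    unfolding ∑

    #-atMostOne : (P? : U.Decidable P) → (∀ {x y} → P x → P y → x ≈ y) → # P? ≤ 1
    #-atMostOne P? unique with Fin.any? (P? ∘ E.from)
    ... | yes (i , Pi) = ℕ.≤-trans (#-mono P? (E.from i ≟_) λ x Px → unique Pi Px) (ℕ.≤-reflexive (#-singleton _))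
    ... | no ¬P rewrite #≡∑ P? =
      ℕ.≤-trans (ℕ.≤-reflexive (trans (ℕ∑.sum-cong-≗ λ i → ind-no (P? (E.from i)) λ Pi → ¬P (i , Pi))
        (trans (sum-const q 0) (ℕ.*-zeroʳ q)))) z≤n

  ∑-# : {R : Carrier → Pred Carrier a} (R? : ∀ x → U.Decidable (R x)) →
    ∑ (λ x → # (R? x)) ≡ ∑ (λ y → # (λ x → R? x y))
  ∑-# R? = trans (∑-cong λ x → #≡∑ (R? x))
    (trans (∑-swap (λ x y → ind (R? x y))) (∑-cong λ y → sym (#≡∑ (λ x → R? x y))))

  -- Double counting: every x satisfying P lies over exactly one y, namely f x.
  ∑-fibres : (P? : U.Decidable P) (f : Carrier → Carrier) →
    ∑ (λ y → # (λ x → P? x ×-dec f x ≟ y)) ≡ # P?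
  ∑-fibres P? f = begin
    ∑ (λ y → # (λ x → P? x ×-dec f x ≟ y))     ≡⟨ ∑-# (λ x y → P? x ×-dec f x ≟ y) ⟨
    ∑ (λ x → # (λ y → P? x ×-dec f x ≟ y))     ≡⟨ ∑-cong (λ x → #≡∑ (λ y → P? x ×-dec f x ≟ y)) ⟩
    ∑ (λ x → ∑ (λ y → ind (P? x ×-dec f x ≟ y))) ≡⟨ ∑-cong (λ x → ∑-cong λ y → ind-× (P? x) (f x ≟ y)) ⟩
    ∑ (λ x → ∑ (λ y → ind (P? x) * ind (f x ≟ y))) ≡⟨ ∑-cong (λ x → ∑-*ˡ (ind (P? x)) (λ y → ind (f x ≟ y))) ⟩
    ∑ (λ x → ind (P? x) * ∑ (λ y → ind (f x ≟ y)))
      ≡⟨ ∑-cong (λ x → trans (cong (ind (P? x) *_) (∑-ind-≟ (f x))) (ℕ.*-identityʳ _)) ⟩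
    ∑ (ind ∘ P?)                               ≡⟨ #≡∑ P? ⟨
    # P?                                       ∎
    where open ≡-Reasoning

  ∑-preimages : (f : Carrier → Carrier) → ∑ (λ y → # (λ x → f x ≟ y)) ≡ q
  ∑-preimages f = begin
    ∑ (λ y → # (λ x → f x ≟ y))           ≡⟨ ∑-# (λ x y → f x ≟ y) ⟨
    ∑ (λ x → # (λ y → f x ≟ y))           ≡⟨ ∑-cong (λ x → #-singleton (f x)) ⟩
    ∑ (λ _ → 1)                           ≡⟨ ∑-const 1 ⟩
    q * 1                                 ≡⟨ ℕ.*-identityʳ q ⟩
    q                                     ∎
    where open ≡-Reasoning

  -- The elements satisfying P are sorted by their value under f: at most one lies over each y, and
  -- none where R fails. Bijections are used below as two injections in opposite directions.
  #-injection : (P? : U.Decidable P) (R? : U.Decidable R) → R Respects _≈_ → ∀ f →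
    (∀ {x} → P x → R (f x)) → (∀ {x y} → P x → P y → f x ≈ f y → x ≈ y) → # P? ≤ # R?
  #-injection P? R? resp f P⇒R inj = begin
    # P?                                       ≡⟨ ∑-fibres P? f ⟨
    ∑ (λ y → # (λ x → P? x ×-dec f x ≟ y))     ≤⟨ ∑-mono-≤ fibre≤ind ⟩
    ∑ (ind ∘ R?)                               ≡⟨ #≡∑ R? ⟨
    # R?                                       ∎
    where
    open ℕ.≤-Reasoning
    fibre≤ind : ∀ y → # (λ x → P? x ×-dec f x ≟ y) ≤ ind (R? y)
    fibre≤ind y with R? y
    ... | yes _ = #-atMostOne (λ x → P? x ×-dec f x ≟ y) λ (Px , fx≈y) (Px′ , fx′≈y) →
      inj Px Px′ (≈-trans fx≈y (≈-sym fx′≈y))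
    ... | no ¬Ry = ℕ.≤-reflexive (#-∅ (λ x → P? x ×-dec f x ≟ y) λ x (Px , fx≈y) → ¬Ry (resp fx≈y (P⇒R Px)))

  opaque
    unfolding ∑

    allFibres≡1 : ∀ {f : Carrier → Carrier} → (∀ {x y} → x ≈ y → f x ≈ f y) →
      (∀ {x y} → f x ≈ f y → x ≈ y) → ∀ y → # (λ x → f x ≟ y) ≡ 1
    allFibres≡1 {f} f-cong inj y = trans
      -- The sum of all fibre sizes runs over representatives, so y is first replaced by its own.
      (#-cong (λ x → f x ≟ y) (λ x → f x ≟ E.from (E.to y))
        (λ x fx≈y → ≈-trans fx≈y (≈-sym (E.strictlyInverseʳ y)))
        (λ x fx≈y → ≈-trans fx≈y (E.strictlyInverseʳ y)))
      (≤1∧n≤sum⇒≡1 (λ i → #-atMostOne (λ x → f x ≟ E.from i) λ p r → inj (≈-trans p (≈-sym r)))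
        (ℕ.≤-reflexive (sym (∑-preimages f))) (E.to y))

  module Reindex {m ℓ′} (M : CommutativeMonoid m ℓ′) where

    private module M = CommutativeMonoid M
    open MonoidSum M using (sum-cong-≋; sum-permute) renaming (sum to sumᴹ)

    -- Conjugation by the enumeration turns g into a permutation of `Fin q`. The monoid is arbitrary
    -- because both a product over the field (Fermat) and a sum over it (the characteristic) are
    -- reindexed.
    sum-reindex : (f : Carrier → M.Carrier) → (∀ {x y} → x ≈ y → f x M.≈ f y) →
      (g h : Carrier → Carrier) → (∀ {x y} → x ≈ y → g x ≈ g y) → (∀ {x y} → x ≈ y → h x ≈ h y) →
      (∀ x → g (h x) ≈ x) → (∀ x → h (g x) ≈ x) →
      sumᴹ (f ∘ E.from) M.≈ sumᴹ (f ∘ g ∘ E.from)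
    sum-reindex f f-cong g h g-cong h-cong gh hg =
      M.trans (sum-permute (f ∘ E.from) π) (sum-cong-≋ λ i → f-cong (E.strictlyInverseʳ (g (E.from i))))
      where
      conj : ∀ u v → (∀ {x y} → x ≈ y → u x ≈ u y) → (∀ x → u (v x) ≈ x) →
        ∀ i → E.to (u (E.from (E.to (v (E.from i))))) ≡ i
      conj u v u-cong uv i = trans (E.to-cong (≈-trans (u-cong (E.strictlyInverseʳ _)) (uv (E.from i))))
                               (E.strictlyInverseˡ i)
      π : Permutation′ q
      π = permutation (E.to ∘ g ∘ E.from) (E.to ∘ h ∘ E.from) (conj g h g-cong gh) (conj h g h-cong hg)

-- Field arithmetic and the bound on the number of roots

module FieldFacts {c ℓ q} (F : FiniteField c ℓ q) where

  open FiniteField F hiding (zero) public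
  open Counting F public
  open Exp commutativeSemiring using (^-congˡ; ^-cong; ^-homo-*; ^-assocʳ; ^-distrib-*) public
  open RingProperties ring using (-1*x≈-x; -‿distribˡ-*; -‿+-comm) public
  open GroupProperties +-group using (//-rightDividesˡ; //-rightDividesʳ)
    renaming (∙-cancelˡ to +-cancelˡ; ∙-cancelʳ to +-cancelʳ;
      x∙y⁻¹≈ε⇒x≈y to x-y≈0⇒x≈y; x≈y⇒x∙y⁻¹≈ε to x≈y⇒x-y≈0) public
  open SemiringSolver commutativeSemiring using (solve; _:+_; _:*_; _:=_) public
  private
    module E = Inverse enumeration
    module ≈R = SetoidReasoning setoid

  *-inverse-unique : ∀ {x y z} → x *ᶠ y ≈ 1# → x *ᶠ z ≈ 1# → y ≈ z
  *-inverse-unique {x} {y} {z} xy≈1 xz≈1 = begin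
    y              ≈⟨ *-identityʳ y ⟨
    y *ᶠ 1#        ≈⟨ *-congˡ xz≈1 ⟨
    y *ᶠ (x *ᶠ z)  ≈⟨ solve 3 (λ x y z → y :* (x :* z) := (x :* y) :* z) ≈-refl x y z ⟩
    (x *ᶠ y) *ᶠ z  ≈⟨ *-congʳ xy≈1 ⟩
    1# *ᶠ z        ≈⟨ *-identityˡ z ⟩
    z              ∎
    where open ≈R

  *-cancelˡ : ∀ {x y z} → ¬ x ≈ 0# → x *ᶠ y ≈ x *ᶠ z → y ≈ z
  *-cancelˡ {x} {y} {z} x≉0 xy≈xz with invertible x x≉0
  ... | w , xw≈1 = begin
    y              ≈⟨ *-identityˡ y ⟨
    1# *ᶠ y        ≈⟨ *-congʳ xw≈1 ⟨
    x *ᶠ w *ᶠ y    ≈⟨ solve 3 (λ x w y → x :* w :* y := w :* (x :* y)) ≈-refl x w y ⟩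
    w *ᶠ (x *ᶠ y)  ≈⟨ *-congˡ xy≈xz ⟩
    w *ᶠ (x *ᶠ z)  ≈⟨ solve 3 (λ x w y → w :* (x :* y) := x :* w :* y) ≈-refl x w z ⟩
    x *ᶠ w *ᶠ z    ≈⟨ *-congʳ xw≈1 ⟩
    1# *ᶠ z        ≈⟨ *-identityˡ z ⟩
    z              ∎
    where open ≈R

  x*y≈0⇒y≈0 : ∀ {x y} → ¬ x ≈ 0# → x *ᶠ y ≈ 0# → y ≈ 0#
  x*y≈0⇒y≈0 x≉0 xy≈0 = *-cancelˡ x≉0 (≈-trans xy≈0 (≈-sym (zeroʳ _)))

  x*y≉0 : ∀ {x y} → ¬ x ≈ 0# → ¬ y ≈ 0# → ¬ x *ᶠ y ≈ 0#
  x*y≉0 x≉0 y≉0 xy≈0 = y≉0 (x*y≈0⇒y≈0 x≉0 xy≈0)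

  x*y≈1⇒x≉0 : ∀ {x y} → x *ᶠ y ≈ 1# → ¬ x ≈ 0#
  x*y≈1⇒x≉0 xy≈1 x≈0 = 1≉0 (≈-trans (≈-sym xy≈1) (≈-trans (*-congʳ x≈0) (zeroˡ _)))

  x^n≉0 : ∀ {x} n → ¬ x ≈ 0# → ¬ x ^ᶠ n ≈ 0#
  x^n≉0 zero    x≉0 = 1≉0
  x^n≉0 (suc n) x≉0 = x*y≉0 x≉0 (x^n≉0 n x≉0)

  x≈0⇒x^n≈0 : ∀ {x} n .{{_ : NonZero n}} → x ≈ 0# → x ^ᶠ n ≈ 0#
  x≈0⇒x^n≈0 (suc n) x≈0 = ≈-trans (*-congʳ x≈0) (zeroˡ _)

  1^n≈1 : ∀ n → 1# ^ᶠ n ≈ 1#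
  1^n≈1 zero    = ≈-refl
  1^n≈1 (suc n) = ≈-trans (*-identityˡ _) (1^n≈1 n)

  m∣n∧x^m≈1⇒x^n≈1 : ∀ {x m n} → m ∣ n → x ^ᶠ m ≈ 1# → x ^ᶠ n ≈ 1#
  m∣n∧x^m≈1⇒x^n≈1 {x} {m} (divides k refl) x^m≈1 = begin
    x ^ᶠ (k * m)    ≈⟨ ^-cong {x = x} ≈-refl (ℕ.*-comm k m) ⟩
    x ^ᶠ (m * k)    ≈⟨ ^-assocʳ x m k ⟨
    (x ^ᶠ m) ^ᶠ k   ≈⟨ ^-congˡ k x^m≈1 ⟩
    1# ^ᶠ k         ≈⟨ 1^n≈1 k ⟩
    1#              ∎
    where open ≈R

  -- Made total by the value 0 at 0, so that it can enter a map between fibres without carrying a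
  -- proof that its argument is nonzero.
  inverse : Carrier → Carrier
  inverse x with x ≟ 0#
  ... | yes _  = 0#
  ... | no x≉0 = proj₁ (invertible x x≉0)

  x*inverse≈1 : ∀ {x} → ¬ x ≈ 0# → x *ᶠ inverse x ≈ 1#
  x*inverse≈1 {x} x≉0 with x ≟ 0#
  ... | yes x≈0 = contradiction x≈0 x≉0
  ... | no x≉0  = proj₂ (invertible x x≉0)

  -- "Polynomial function of degree < n", by iterated divided differences
  -- g = (f x - f y) / (x - y), with the terms moved so that no subtraction occurs.
  data PolynomialBelow : ℕ → (Carrier → Carrier) → Set (c Level.⊔ ℓ) where
    vanishing : ∀ {f} → (∀ x → f x ≈ 0#) → PolynomialBelow 0 f
    dividedDifference : ∀ {n f} (g : Carrier → Carrier → Carrier) →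
      (∀ y → PolynomialBelow n (g y)) →
      (∀ y x → f x +ᶠ y *ᶠ g y x ≈ f y +ᶠ x *ᶠ g y x) → PolynomialBelow (suc n) f

  polynomial-weaken : ∀ {n f} → PolynomialBelow n f → PolynomialBelow (suc n) f
  polynomial-weaken (vanishing f≈0) = dividedDifference (λ _ _ → 0#) (λ _ → vanishing λ _ → ≈-refl)
    λ y x → +-cong (≈-trans (f≈0 x) (≈-sym (f≈0 y))) (≈-trans (zeroʳ y) (≈-sym (zeroʳ x)))
  polynomial-weaken (dividedDifference g pg eq) = dividedDifference g (polynomial-weaken ∘ pg) eq

  polynomial-+ : ∀ {n f g} → PolynomialBelow n f → PolynomialBelow n g →
    PolynomialBelow n (λ x → f x +ᶠ g x)
  polynomial-+ (vanishing f≈0) (vanishing g≈0) =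
    vanishing λ x → ≈-trans (+-cong (f≈0 x) (g≈0 x)) (+-identityʳ 0#)
  polynomial-+ {f = f} {g} (dividedDifference f′ pf eqf) (dividedDifference g′ pg eqg) =
    dividedDifference (λ y x → f′ y x +ᶠ g′ y x) (λ y → polynomial-+ (pf y) (pg y)) λ y x → begin
      f x +ᶠ g x +ᶠ y *ᶠ (f′ y x +ᶠ g′ y x)
        ≈⟨ regroup (f x) (g x) y (f′ y x) (g′ y x) ⟩
      (f x +ᶠ y *ᶠ f′ y x) +ᶠ (g x +ᶠ y *ᶠ g′ y x)
        ≈⟨ +-cong (eqf y x) (eqg y x) ⟩
      (f y +ᶠ x *ᶠ f′ y x) +ᶠ (g y +ᶠ x *ᶠ g′ y x)
        ≈⟨ regroup (f y) (g y) x (f′ y x) (g′ y x) ⟨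
      f y +ᶠ g y +ᶠ x *ᶠ (f′ y x +ᶠ g′ y x) ∎
    where
    open ≈R
    regroup : ∀ a b y d e → a +ᶠ b +ᶠ y *ᶠ (d +ᶠ e) ≈ (a +ᶠ y *ᶠ d) +ᶠ (b +ᶠ y *ᶠ e)
    regroup = solve 5 (λ a b y d e → a :+ b :+ y :* (d :+ e) := (a :+ y :* d) :+ (b :+ y :* e)) ≈-refl

  polynomial-* : ∀ {n f} a → PolynomialBelow n f → PolynomialBelow n (λ x → a *ᶠ f x)
  polynomial-* a (vanishing f≈0) = vanishing λ x → ≈-trans (*-congˡ (f≈0 x)) (zeroʳ a)
  polynomial-* {f = f} a (dividedDifference g pg eq) =
    dividedDifference (λ y x → a *ᶠ g y x) (λ y → polynomial-* a (pg y)) λ y x → begin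
      a *ᶠ f x +ᶠ y *ᶠ (a *ᶠ g y x) ≈⟨ factor a (f x) y (g y x) ⟩
      a *ᶠ (f x +ᶠ y *ᶠ g y x)      ≈⟨ *-congˡ (eq y x) ⟩
      a *ᶠ (f y +ᶠ x *ᶠ g y x)      ≈⟨ factor a (f y) x (g y x) ⟨
      a *ᶠ f y +ᶠ x *ᶠ (a *ᶠ g y x) ∎
    where
    open ≈R
    factor : ∀ a b y d → a *ᶠ b +ᶠ y *ᶠ (a *ᶠ d) ≈ a *ᶠ (b +ᶠ y *ᶠ d)
    factor = solve 4 (λ a b y d → a :* b :+ y :* (a :* d) := a :* (b :+ y :* d)) ≈-refl

  polynomial-const : ∀ {n} a → PolynomialBelow (suc n) (λ _ → a)
  polynomial-const {zero}  a = dividedDifference (λ _ _ → 0#) (λ _ → vanishing λ _ → ≈-refl)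
    λ y x → +-congˡ (≈-trans (zeroʳ y) (≈-sym (zeroʳ x)))
  polynomial-const {suc n} a = polynomial-weaken (polynomial-const a)

  -- The recursion for the divided difference comes from x x^n - y y^n = (x - y) x^n + y (x^n -
  -- y^n).
  polynomial-^ : ∀ n → PolynomialBelow (suc n) (_^ᶠ n)
  polynomial-^ zero    = polynomial-const 1#
  polynomial-^ (suc n) with polynomial-^ n
  ... | p@(dividedDifference g pg eq) = dividedDifference (λ y x → x ^ᶠ n +ᶠ y *ᶠ g y x)
    (λ y → polynomial-+ p (polynomial-* y (polynomial-weaken (pg y)))) λ y x → begin
      x *ᶠ x ^ᶠ n +ᶠ y *ᶠ (x ^ᶠ n +ᶠ y *ᶠ g y x) ≈⟨ +-congˡ (*-congˡ (eq y x)) ⟩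
      x *ᶠ x ^ᶠ n +ᶠ y *ᶠ (y ^ᶠ n +ᶠ x *ᶠ g y x)
        ≈⟨ solve 5 (λ x a y b d → x :* a :+ y :* (b :+ x :* d) := y :* b :+ x :* (a :+ y :* d)) ≈-refl
             x (x ^ᶠ n) y (y ^ᶠ n) (g y x) ⟩
      y *ᶠ y ^ᶠ n +ᶠ x *ᶠ (x ^ᶠ n +ᶠ y *ᶠ g y x) ∎
    where open ≈R

  x*z≈y*z⇒z≈0 : ∀ {x y z} → ¬ x ≈ y → x *ᶠ z ≈ y *ᶠ z → z ≈ 0#
  x*z≈y*z⇒z≈0 {x} {y} {z} x≉y xz≈yz = x*y≈0⇒y≈0 (x≉y ∘ x-y≈0⇒x≈y x y) (begin
    (x -ᶠ y) *ᶠ z            ≈⟨ distribʳ z x (- y) ⟩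
    x *ᶠ z +ᶠ - y *ᶠ z       ≈⟨ +-congˡ (-‿distribˡ-* y z) ⟨
    x *ᶠ z -ᶠ y *ᶠ z         ≈⟨ x≈y⇒x-y≈0 xz≈yz ⟩
    0#                       ∎)
    where open ≈R

  -- Splitting off a root y leaves f x = (x - y) g y x, and the other roots, being distinct from y,
  -- are roots of `g y`. By induction `g y` vanishes everywhere, hence so does f.
  tooManyRoots⇒vanishing : ∀ {n f} → PolynomialBelow n f → ∀ {xs} →
    AllPairs (λ x y → ¬ x ≈ y) xs → All (λ x → f x ≈ 0#) xs → n ≤ length xs → ∀ x → f x ≈ 0#
  tooManyRoots⇒vanishing (vanishing f≈0) _ _ _ = f≈0
  tooManyRoots⇒vanishing {f = f} (dividedDifference g pg eq) {y ∷ ys} (y∉ys ∷ ys!) (fy≈0 ∷ fys≈0) (s≤s n≤) x = begin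
    f x                 ≈⟨ +-identityʳ (f x) ⟨
    f x +ᶠ 0#           ≈⟨ +-congˡ (≈-trans (*-congˡ (gy≈0 x)) (zeroʳ y)) ⟨
    f x +ᶠ y *ᶠ g y x   ≈⟨ eq y x ⟩
    f y +ᶠ x *ᶠ g y x   ≈⟨ +-cong fy≈0 (≈-trans (*-congˡ (gy≈0 x)) (zeroʳ x)) ⟩
    0# +ᶠ 0#            ≈⟨ +-identityʳ 0# ⟩
    0#                  ∎
    where
    open ≈R
    root : ∀ {w} → ¬ y ≈ w × f w ≈ 0# → g y w ≈ 0#
    root {w} (y≉w , fw≈0) = x*z≈y*z⇒z≈0 y≉w (begin
      y *ᶠ g y w          ≈⟨ +-identityˡ _ ⟨
      0# +ᶠ y *ᶠ g y w    ≈⟨ +-congʳ fw≈0 ⟨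
      f w +ᶠ y *ᶠ g y w   ≈⟨ eq y w ⟩
      f y +ᶠ w *ᶠ g y w   ≈⟨ +-congʳ fy≈0 ⟩
      0# +ᶠ w *ᶠ g y w    ≈⟨ +-identityˡ _ ⟩
      w *ᶠ g y w          ∎)
    gy≈0 = tooManyRoots⇒vanishing (pg y) ys! (All.zipWith root (y∉ys , fys≈0)) n≤

  elements-distinct : AllPairs (λ x y → ¬ x ≈ y) elements
  elements-distinct = AllPairs.map⁺ (AllPairs.tabulate⁺ λ i≢j from≈ →
    i≢j (trans (sym (E.strictlyInverseˡ _)) (trans (E.to-cong from≈) (E.strictlyInverseˡ _))))

  -- With more than n roots, x^n - a would vanish everywhere, in particular at 0, where its value is
  -- -a because n is positive.
  #nth-roots≤n : ∀ n .{{_ : NonZero n}} {a} → ¬ a ≈ 0# → # (λ x → (x ^ᶠ n) ≟ a) ≤ n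
  #nth-roots≤n n@(suc _) {a} a≉0 = ℕ.≮⇒≥ λ n<# → a≉0 (begin
    a                   ≈⟨ x-y≈0⇒x≈y _ _ (tooManyRoots⇒vanishing
                             (polynomial-+ (polynomial-^ n) (polynomial-const (- a)))
                             (AllPairs.filter⁺ root? elements-distinct)
                             (All.map x≈y⇒x-y≈0 (All.all-filter root? elements)) n<# 0#) ⟨
    0# ^ᶠ n             ≈⟨ x≈0⇒x^n≈0 n ≈-refl ⟩
    0#                  ∎)
    where
    open ≈R
    root? = λ x → (x ^ᶠ n) ≟ a

  1+#nonzero≡q : 1 + # (λ x → ¬? (x ≟ 0#)) ≡ q
  1+#nonzero≡q = begin
    1 + # nonzero?          ≡⟨ cong (_+ # nonzero?) (#-singleton 0#) ⟨
    # (0# ≟_) + # nonzero?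
      ≡⟨ #-⊎ (0# ≟_) nonzero? (λ _ → yes tt) (λ _ → tt) (λ _ → tt) split (λ 0≈x x≉0 → x≉0 (≈-sym 0≈x)) ⟨
    # (λ _ → yes tt)        ≡⟨ #≡∑ (λ _ → yes tt) ⟩
    ∑ (λ _ → 1)             ≡⟨ ∑-const 1 ⟩
    q * 1                   ≡⟨ ℕ.*-identityʳ q ⟩
    q                       ∎
    where
    open ≡-Reasoning
    nonzero? = λ x → ¬? (x ≟ 0#)
    split : ∀ {x} → ⊤ → 0# ≈ x ⊎ ¬ x ≈ 0#
    split {x} _ with x ≟ 0#
    ... | yes x≈0 = inj₁ (≈-sym x≈0)
    ... | no x≉0  = inj₂ x≉0

  #nonzero : # (λ x → ¬? (x ≟ 0#)) ≡ q ∸ 1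
  #nonzero = cong (_∸ 1) 1+#nonzero≡q

-- Fermat's theorem and roots of unity

module Powers {c ℓ q} (F : FiniteField c ℓ q) where

  open FieldFacts F public
  private
    module E = Inverse enumeration
    module ≈R = SetoidReasoning setoid
    module Π = MonoidSum *-commutativeMonoid

  Π-power : ∀ x {n} (k : Fin n → ℕ) → Π.sum (λ i → x ^ᶠ k i) ≈ x ^ᶠ sumᵛ k
  Π-power x {zero}  k = ≈-refl
  Π-power x {suc n} k = ≈-trans (*-congˡ (Π-power x (k ∘ suc))) (≈-sym (^-homo-* x (k zero) _))

  Π≉0 : ∀ {n} (f : Fin n → Carrier) → (∀ i → ¬ f i ≈ 0#) → ¬ Π.sum f ≈ 0#
  Π≉0 {zero}  f f≉0 = 1≉0
  Π≉0 {suc n} f f≉0 = x*y≉0 (f≉0 zero) (Π≉0 (f ∘ suc) (f≉0 ∘ suc))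

  -- Replacing 0 by 1 allows the product of the nonzero elements to be taken over the whole field,
  -- where it can be reindexed.
  zeroToOne : Carrier → Carrier
  zeroToOne x = if does (x ≟ 0#) then 1# else x

  zeroToOne-zero : ∀ {x} → x ≈ 0# → zeroToOne x ≈ 1#
  zeroToOne-zero {x} x≈0 = reflexive (cong (if_then 1# else x) (dec-true (x ≟ 0#) x≈0))

  zeroToOne-nonzero : ∀ {x} → ¬ x ≈ 0# → zeroToOne x ≈ x
  zeroToOne-nonzero {x} x≉0 = reflexive (cong (if_then 1# else x) (dec-false (x ≟ 0#) x≉0))

  zeroToOne≉0 : ∀ x → ¬ zeroToOne x ≈ 0#
  zeroToOne≉0 x eq = case x ≟ 0# of λ where
    (yes x≈0) → 1≉0 (≈-trans (≈-sym (zeroToOne-zero x≈0)) eq)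
    (no x≉0)  → x≉0 (≈-trans (≈-sym (zeroToOne-nonzero x≉0)) eq)

  zeroToOne-cong : ∀ {x y} → x ≈ y → zeroToOne x ≈ zeroToOne y
  zeroToOne-cong {x} {y} x≈y = case x ≟ 0# of λ where
    (yes x≈0) → ≈-trans (zeroToOne-zero x≈0) (≈-sym (zeroToOne-zero (≈-trans (≈-sym x≈y) x≈0)))
    (no x≉0)  → ≈-trans (zeroToOne-nonzero x≉0)
                  (≈-trans x≈y (≈-sym (zeroToOne-nonzero (x≉0 ∘ ≈-trans x≈y))))

  -- The indicator in the exponent leaves out the factor a at x = 0; summed over the field, these
  -- exponents give q - 1.
  zeroToOne-scale : ∀ {a} → ¬ a ≈ 0# → ∀ x →
    zeroToOne (a *ᶠ x) ≈ a ^ᶠ ind (¬? (x ≟ 0#)) *ᶠ zeroToOne x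
  zeroToOne-scale {a} a≉0 x = let open ≈R in case x ≟ 0# of λ where
    (yes x≈0) → begin
      zeroToOne (a *ᶠ x)                         ≈⟨ zeroToOne-zero (≈-trans (*-congˡ x≈0) (zeroʳ a)) ⟩
      1#                                         ≈⟨ *-identityʳ 1# ⟨
      1# *ᶠ 1#
        ≈⟨ *-cong (^-cong {x = a} ≈-refl (ind-no (¬? (x ≟ 0#)) (λ x≉0 → x≉0 x≈0))) (zeroToOne-zero x≈0) ⟨
      a ^ᶠ ind (¬? (x ≟ 0#)) *ᶠ zeroToOne x      ∎
    (no x≉0) → begin
      zeroToOne (a *ᶠ x)                         ≈⟨ zeroToOne-nonzero (x*y≉0 a≉0 x≉0) ⟩
      a *ᶠ x                                     ≈⟨ *-congʳ (*-identityʳ a) ⟨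
      a ^ᶠ 1 *ᶠ x
        ≈⟨ *-cong (^-cong {x = a} ≈-refl (ind-yes (¬? (x ≟ 0#)) x≉0)) (zeroToOne-nonzero x≉0) ⟨
      a ^ᶠ ind (¬? (x ≟ 0#)) *ᶠ zeroToOne x      ∎

  -- Multiplication by a permutes the nonzero elements, so it preserves their product.
  fermat : ∀ {a} → ¬ a ≈ 0# → a ^ᶠ (q ∸ 1) ≈ 1#
  fermat {a} a≉0 = begin
    a ^ᶠ (q ∸ 1)                          ≡⟨ cong (a ^ᶠ_) (trans (sym #nonzero) (trans (#≡∑ _) (∑≡sum _))) ⟩
    a ^ᶠ sumᵛ (λ i → k (E.from i))         ≈⟨ Π-power a (k ∘ E.from) ⟨
    Π.sum (λ i → a ^ᶠ k (E.from i))       ≈⟨ *-cancelˡ P≉0 (begin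
        P *ᶠ Π.sum (λ i → a ^ᶠ k (E.from i))
          ≈⟨ *-comm P _ ⟩
        Π.sum (λ i → a ^ᶠ k (E.from i)) *ᶠ P
          ≈⟨ Π.∑-distrib-+ (λ i → a ^ᶠ k (E.from i)) (zeroToOne ∘ E.from) ⟨
        Π.sum (λ i → a ^ᶠ k (E.from i) *ᶠ zeroToOne (E.from i))
          ≈⟨ Π.sum-cong-≋ (λ i → zeroToOne-scale a≉0 (E.from i)) ⟨
        Π.sum (λ i → zeroToOne (a *ᶠ E.from i))
          ≈⟨ sum-reindex zeroToOne zeroToOne-cong (a *ᶠ_) (inverse a *ᶠ_) *-congˡ *-congˡ
               (λ x → cancel x (x*inverse≈1 a≉0))
               (λ x → cancel x (≈-trans (*-comm _ a) (x*inverse≈1 a≉0))) ⟨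
        P
          ≈⟨ *-identityʳ P ⟨
        P *ᶠ 1# ∎) ⟩
    1#                                    ∎
    where
    open ≈R
    open Reindex *-commutativeMonoid
    k : Carrier → ℕ
    k x = ind (¬? (x ≟ 0#))
    P = Π.sum (zeroToOne ∘ E.from)
    P≉0 : ¬ P ≈ 0#
    P≉0 = Π≉0 (zeroToOne ∘ E.from) (zeroToOne≉0 ∘ E.from)
    cancel : ∀ {u v} x → u *ᶠ v ≈ 1# → u *ᶠ (v *ᶠ x) ≈ x
    cancel x uv≈1 = ≈-trans (≈-sym (*-assoc _ _ x)) (≈-trans (*-congʳ uv≈1) (*-identityˡ x))

  x^[m+n]≈1∧x^n≈1⇒x^m≈1 : ∀ {x} m n → x ^ᶠ (m + n) ≈ 1# → x ^ᶠ n ≈ 1# → x ^ᶠ m ≈ 1#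
  x^[m+n]≈1∧x^n≈1⇒x^m≈1 {x} m n x^[m+n]≈1 x^n≈1 = begin
    x ^ᶠ m                ≈⟨ *-identityʳ _ ⟨
    x ^ᶠ m *ᶠ 1#          ≈⟨ *-congˡ x^n≈1 ⟨
    x ^ᶠ m *ᶠ x ^ᶠ n      ≈⟨ ^-homo-* x m n ⟨
    x ^ᶠ (m + n)          ≈⟨ x^[m+n]≈1 ⟩
    1#                    ∎
    where open ≈R

  x^gcd≈1 : ∀ {x} m n → x ^ᶠ m ≈ 1# → x ^ᶠ n ≈ 1# → x ^ᶠ gcd m n ≈ 1#
  x^gcd≈1 {x} m n x^m≈1 x^n≈1 with Bézout.identity (gcd-GCD m n)
  ... | Bézout.+- a b eq = x^[m+n]≈1∧x^n≈1⇒x^m≈1 (gcd m n) (b * n)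
    (subst (λ j → x ^ᶠ j ≈ 1#) (sym eq) (m∣n∧x^m≈1⇒x^n≈1 (n∣m*n a) x^m≈1)) (m∣n∧x^m≈1⇒x^n≈1 (n∣m*n b) x^n≈1)
  ... | Bézout.-+ a b eq = x^[m+n]≈1∧x^n≈1⇒x^m≈1 (gcd m n) (a * m)
    (subst (λ j → x ^ᶠ j ≈ 1#) (sym eq) (m∣n∧x^m≈1⇒x^n≈1 (n∣m*n b) x^n≈1)) (m∣n∧x^m≈1⇒x^n≈1 (n∣m*n a) x^m≈1)

  1≤q∸1 : 1 ≤ q ∸ 1
  1≤q∸1 = subst₂ _≤_ (#-singleton 1#) #nonzero
    (#-mono (1# ≟_) (λ x → ¬? (x ≟ 0#)) λ x 1≈x x≈0 → 1≉0 (≈-trans 1≈x x≈0))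

  x^n≈1⇒x≉0 : ∀ {x} n .{{_ : NonZero n}} → x ^ᶠ n ≈ 1# → ¬ x ≈ 0#
  x^n≈1⇒x≉0 n x^n≈1 x≈0 = 1≉0 (≈-trans (≈-sym x^n≈1) (x≈0⇒x^n≈0 n x≈0))

  -- The k-th power map sends the nonzero elements into the d-th roots of unity,
  -- with fibres of size at most k.
  d≤#roots-of-unity : ∀ d .{{_ : NonZero d}} → d ∣ q ∸ 1 → d ≤ # (λ x → (x ^ᶠ d) ≟ 1#)
  -- A zero cofactor would make q - 1 zero, although 1 is a nonzero element.
  d≤#roots-of-unity d (divides zero eq) = contradiction (subst (1 ≤_) eq 1≤q∸1) λ ()
  d≤#roots-of-unity d (divides k@(suc _) eq) = ℕ.*-cancelˡ-≤ k (begin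
    k * d                                                         ≡⟨ trans (sym eq) (sym #nonzero) ⟩
    # nonzero?                                                    ≡⟨ ∑-fibres nonzero? (_^ᶠ k) ⟨
    ∑ (λ y → # (λ x → nonzero? x ×-dec (x ^ᶠ k) ≟ y))             ≤⟨ ∑-mono-≤ fibre≤ ⟩
    ∑ (λ y → k * ind (root? y))                                   ≡⟨ ∑-*ˡ k (ind ∘ root?) ⟩
    k * ∑ (ind ∘ root?)                                           ≡⟨ cong (k *_) (#≡∑ root?) ⟨
    k * # root?                                                   ∎)
    where
    open ℕ.≤-Reasoning
    nonzero? = λ x → ¬? (x ≟ 0#)
    root? = λ x → (x ^ᶠ d) ≟ 1#
    fibre≤ : ∀ y → # (λ x → nonzero? x ×-dec (x ^ᶠ k) ≟ y) ≤ k * ind (root? y)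
    fibre≤ y = ≤-*-ind (root? y)
      (λ y^d≈1 → ℕ.≤-trans
        (#-mono (λ x → nonzero? x ×-dec (x ^ᶠ k) ≟ y) (λ x → (x ^ᶠ k) ≟ y) λ _ → proj₂)
        (#nth-roots≤n k (x^n≈1⇒x≉0 d y^d≈1)))
      (λ y^d≉1 → #-∅ (λ x → nonzero? x ×-dec (x ^ᶠ k) ≟ y) λ x (x≉0 , x^k≈y) → y^d≉1
        (≈-trans (^-congˡ d (≈-sym x^k≈y))
          (≈-trans (^-assocʳ x k d) (≈-trans (^-cong {x = x} ≈-refl (sym eq)) (fermat x≉0)))))

  -- Fermat's theorem and Bézout's identity reduce the exponent n to g = gcd(n, q - 1). Since g
  -- divides q - 1, the upper and the lower bound on the number of g-th roots of unity meet.
  #roots-of-unity : ∀ n .{{_ : NonZero n}} → # (λ x → (x ^ᶠ n) ≟ 1#) ≡ gcd n (q ∸ 1)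
  #roots-of-unity n = trans
    (#-cong (λ x → (x ^ᶠ n) ≟ 1#) (λ x → (x ^ᶠ g) ≟ 1#)
      (λ x x^n≈1 → x^gcd≈1 n (q ∸ 1) x^n≈1 (fermat (x^n≈1⇒x≉0 n x^n≈1)))
      (λ x → m∣n∧x^m≈1⇒x^n≈1 (gcd[m,n]∣m n (q ∸ 1))))
    (ℕ.≤-antisym (#nth-roots≤n g 1≉0) (d≤#roots-of-unity g (gcd[m,n]∣n n (q ∸ 1))))
    where
    g = gcd n (q ∸ 1)
    instance
      g≢0 : NonZero g
      g≢0 = ≢-nonZero λ eq → ≢-nonZero⁻¹ n (gcd[m,n]≡0⇒m≡0 eq)

  -- One solution `a` suffices: multiplication by `a` and by its inverse exchanges the n-th roots of
  -- unity with the solutions.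
  #twisted-roots-of-unity : ∀ n .{{_ : NonZero n}} {a b} → b *ᶠ a ^ᶠ n ≈ 1# →
    # (λ x → (b *ᶠ x ^ᶠ n) ≟ 1#) ≡ gcd n (q ∸ 1)
  #twisted-roots-of-unity n {a} {b} ba^n≈1 = trans (ℕ.≤-antisym
    (#-injection twisted? root? (λ x≈y x^n≈1 → ≈-trans (^-congˡ n (≈-sym x≈y)) x^n≈1)
      (inverse a *ᶠ_) untwist (λ _ _ → *-cancelˡ (x*y≈1⇒x≉0 inv*a≈1)))
    (#-injection root? twisted? (λ x≈y → ≈-trans (*-congˡ (^-congˡ n (≈-sym x≈y))))
      (a *ᶠ_) twist (λ _ _ → *-cancelˡ a≉0)))
    (#roots-of-unity n)
    where
    open ≈R
    twisted? = λ x → (b *ᶠ x ^ᶠ n) ≟ 1#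
    root? = λ x → (x ^ᶠ n) ≟ 1#
    a≉0 : ¬ a ≈ 0#
    a≉0 a≈0 = x*y≈1⇒x≉0 (≈-trans (*-comm _ b) ba^n≈1) (x≈0⇒x^n≈0 n a≈0)
    inv*a≈1 : inverse a *ᶠ a ≈ 1#
    inv*a≈1 = ≈-trans (*-comm _ a) (x*inverse≈1 a≉0)
    untwist : ∀ {x} → b *ᶠ x ^ᶠ n ≈ 1# → (inverse a *ᶠ x) ^ᶠ n ≈ 1#
    untwist {x} bx^n≈1 = begin
      (inverse a *ᶠ x) ^ᶠ n           ≈⟨ ^-distrib-* (inverse a) x n ⟩
      inverse a ^ᶠ n *ᶠ x ^ᶠ n        ≈⟨ *-congˡ (*-inverse-unique bx^n≈1 ba^n≈1) ⟩
      inverse a ^ᶠ n *ᶠ a ^ᶠ n        ≈⟨ ^-distrib-* (inverse a) a n ⟨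
      (inverse a *ᶠ a) ^ᶠ n           ≈⟨ ^-congˡ n inv*a≈1 ⟩
      1# ^ᶠ n                         ≈⟨ 1^n≈1 n ⟩
      1#                              ∎
    twist : ∀ {x} → x ^ᶠ n ≈ 1# → b *ᶠ (a *ᶠ x) ^ᶠ n ≈ 1#
    twist {x} x^n≈1 = begin
      b *ᶠ (a *ᶠ x) ^ᶠ n              ≈⟨ *-congˡ (^-distrib-* a x n) ⟩
      b *ᶠ (a ^ᶠ n *ᶠ x ^ᶠ n)         ≈⟨ *-congˡ (≈-trans (*-congˡ x^n≈1) (*-identityʳ _)) ⟩
      b *ᶠ a ^ᶠ n                     ≈⟨ ba^n≈1 ⟩
      1#                              ∎

-- Fibres of additive maps

module AdditiveMaps {c ℓ q} (F : FiniteField c ℓ q) where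

  open Powers F public
  private module ≈R = SetoidReasoning setoid

  record AdditiveMap : Set (c Level.⊔ ℓ) where
    field
      ⟦_⟧     : Carrier → Carrier
      ⟦⟧-cong : ∀ {x y} → x ≈ y → ⟦ x ⟧ ≈ ⟦ y ⟧
      ⟦⟧-+    : ∀ x y → ⟦ x +ᶠ y ⟧ ≈ ⟦ x ⟧ +ᶠ ⟦ y ⟧

    ⟦⟧-- : ∀ x y → ⟦ x -ᶠ y ⟧ ≈ ⟦ x ⟧ -ᶠ ⟦ y ⟧
    ⟦⟧-- x y = begin
      ⟦ x -ᶠ y ⟧                       ≈⟨ +-identityʳ _ ⟨
      ⟦ x -ᶠ y ⟧ +ᶠ 0#                 ≈⟨ +-congˡ (-‿inverseʳ ⟦ y ⟧) ⟨
      ⟦ x -ᶠ y ⟧ +ᶠ (⟦ y ⟧ -ᶠ ⟦ y ⟧)   ≈⟨ +-assoc _ _ _ ⟨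
      ⟦ x -ᶠ y ⟧ +ᶠ ⟦ y ⟧ -ᶠ ⟦ y ⟧     ≈⟨ +-congʳ (⟦⟧-+ (x -ᶠ y) y) ⟨
      ⟦ x -ᶠ y +ᶠ y ⟧ -ᶠ ⟦ y ⟧         ≈⟨ +-congʳ (⟦⟧-cong (//-rightDividesˡ y x)) ⟩
      ⟦ x ⟧ -ᶠ ⟦ y ⟧                   ∎
      where open ≈R

    kernelSize : ℕ
    kernelSize = # (λ x → ⟦ x ⟧ ≟ 0#)

    #fibre≡kernelSize : ∀ {a b} → ⟦ a ⟧ ≈ b → # (λ x → ⟦ x ⟧ ≟ b) ≡ kernelSize
    #fibre≡kernelSize {a} {b} fa≈b = ℕ.≤-antisym
      (#-injection (λ x → ⟦ x ⟧ ≟ b) (λ x → ⟦ x ⟧ ≟ 0#) resp (_-ᶠ a)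
        (λ {x} fx≈b → ≈-trans (⟦⟧-- x a) (x≈y⇒x-y≈0 (≈-trans fx≈b (≈-sym fa≈b))))
        (λ {x} {y} _ _ → +-cancelʳ (- a) x y))
      (#-injection (λ x → ⟦ x ⟧ ≟ 0#) (λ x → ⟦ x ⟧ ≟ b) resp (_+ᶠ a)
        (λ {x} fx≈0 → ≈-trans (⟦⟧-+ x a) (≈-trans (+-cong fx≈0 fa≈b) (+-identityˡ b)))
        (λ {x} {y} _ _ → +-cancelʳ a x y))
      where
      resp : ∀ {b} → (λ x → ⟦ x ⟧ ≈ b) Respects _≈_
      resp x≈y = ≈-trans (⟦⟧-cong (≈-sym x≈y))

    trivialKernel⇒#fibre≡1 : (∀ x → ⟦ x ⟧ ≈ 0# → x ≈ 0#) → ∀ b → # (λ x → ⟦ x ⟧ ≟ b) ≡ 1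
    trivialKernel⇒#fibre≡1 trivial = allFibres≡1 ⟦⟧-cong λ {x} {y} fx≈fy →
      x-y≈0⇒x≈y x y (trivial (x -ᶠ y) (≈-trans (⟦⟧-- x y) (x≈y⇒x-y≈0 fx≈fy)))

-- The characteristic and the additivity of p-power maps

module Frobenius {c ℓ} {p m} (p-prime : Prime p) (F : FiniteField c ℓ (p ^ m)) where

  open AdditiveMaps F public
  private
    module E = Inverse enumeration
    module ≈R = SetoidReasoning setoid
  open Mult semiring using (×-congˡ; ×-congʳ; ×-assoc-*; ×1-homo-*; ×-homo-1)
    renaming (_×_ to _·_)
  open SemiringSum semiring using (sum-replicate; sum-init-last; sum-cong-≋; sum-replicate-zero; ∑-distrib-+)
    renaming (sum to sumᶠ)

  -- Translation by 1 permutes F, so it preserves the sum of all elements.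
  q×1≈0 : (p ^ m) · 1# ≈ 0#
  q×1≈0 = +-cancelˡ S _ _ (begin
    S +ᶠ (p ^ m) · 1#                       ≈⟨ +-congˡ (sum-replicate (p ^ m)) ⟨
    S +ᶠ sumᶠ {p ^ m} (λ _ → 1#)            ≈⟨ ∑-distrib-+ E.from (λ _ → 1#) ⟨
    sumᶠ (λ i → E.from i +ᶠ 1#)             ≈⟨ sum-reindex id id (_+ᶠ 1#) (_-ᶠ 1#) +-congʳ +-congʳ
                                                 (//-rightDividesˡ 1#) (//-rightDividesʳ 1#) ⟨
    S                                       ≈⟨ +-identityʳ S ⟨
    S +ᶠ 0#                                 ∎)
    where
    open ≈R
    open Reindex +-commutativeMonoid
    S = sumᶠ E.from

  p^n×1≈[p×1]^n : ∀ n → (p ^ n) · 1# ≈ (p · 1#) ^ᶠ n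
  p^n×1≈[p×1]^n zero    = ×-homo-1 1#
  p^n×1≈[p×1]^n (suc n) = ≈-trans (×1-homo-* p (p ^ n)) (*-congˡ (p^n×1≈[p×1]^n n))

  -- The cardinality only shows that the m-th power of p · 1 is zero; a field has no nonzero
  -- nilpotent element.
  p×1≈0 : p · 1# ≈ 0#
  p×1≈0 with (p · 1#) ≟ 0#
  ... | yes eq = eq
  ... | no neq = contradiction (≈-trans (≈-sym (p^n×1≈[p×1]^n m)) q×1≈0) (x^n≉0 m neq)

  p∣n⇒n×x≈0 : ∀ {n} → p ∣ n → ∀ x → n · x ≈ 0#
  p∣n⇒n×x≈0 (divides k refl) x = begin
    (k * p) · x            ≈⟨ ×-congʳ (k * p) (*-identityˡ x) ⟨
    (k * p) · (1# *ᶠ x)    ≈⟨ ×-assoc-* (k * p) 1# x ⟨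
    (k * p) · 1# *ᶠ x      ≈⟨ *-congʳ (×1-homo-* k p) ⟩
    k · 1# *ᶠ p · 1# *ᶠ x  ≈⟨ *-congʳ (≈-trans (*-congˡ p×1≈0) (zeroʳ _)) ⟩
    0# *ᶠ x                ≈⟨ zeroˡ x ⟩
    0#                     ∎
    where open ≈R

  [x+y]^p≈x^p+y^p : ∀ x y → (x +ᶠ y) ^ᶠ p ≈ x ^ᶠ p +ᶠ y ^ᶠ p
  [x+y]^p≈x^p+y^p x y = expand p refl
    where
    open ≈R
    open Binomial commutativeSemiring using (theorem; binomialTerm)
    -- Keeping n apart from p exposes the successor that splits off the end terms of the binomial
    -- sum, while the primality of p remains available.
    expand : ∀ n → n ≡ p → (x +ᶠ y) ^ᶠ n ≈ x ^ᶠ n +ᶠ y ^ᶠ n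
    expand zero    eq = contradiction (subst Prime (sym eq) p-prime) ¬prime[0]
    expand (suc n) eq = begin
      (x +ᶠ y) ^ᶠ suc n                                 ≈⟨ theorem (suc n) x y ⟩
      t zero +ᶠ sumᶠ (t ∘ suc)                          ≈⟨ +-congˡ (sum-init-last (t ∘ suc)) ⟩
      t zero +ᶠ (sumᶠ (t ∘ suc ∘ inject₁) +ᶠ t (suc (fromℕᶠ n)))
        ≈⟨ +-cong first (+-cong (≈-trans (sum-cong-≋ middle) (sum-replicate-zero n)) last) ⟩
      y ^ᶠ suc n +ᶠ (0# +ᶠ x ^ᶠ suc n)                  ≈⟨ ≈-trans (+-congˡ (+-identityˡ _)) (+-comm _ _) ⟩
      x ^ᶠ suc n +ᶠ y ^ᶠ suc n                          ∎
      where
      t = binomialTerm x y (suc n)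
      first : t zero ≈ y ^ᶠ suc n
      first = ≈-trans (×-homo-1 _) (*-identityˡ _)
      middle : ∀ i → t (suc (inject₁ i)) ≈ 0#
      -- The index `suc (toℕ (inject₁ i))` lies strictly between 0 and p.
      middle i = p∣n⇒n×x≈0 (subst (_∣ suc n C suc (toℕ (inject₁ i))) eq
        (prime∣pCk (subst Prime (sym eq) p-prime) z<s
          (s<s (subst (_< n) (sym (Fin.toℕ-inject₁ i)) (Fin.toℕ<n i))))) _
      last : t (suc (fromℕᶠ n)) ≈ x ^ᶠ suc n
      last = top (toℕ (fromℕᶠ n)) (Fin.toℕ-fromℕ n)
        where
        -- The last index equals n only propositionally, so it is generalised to k before being
        -- identified with n.
        top : ∀ k → k ≡ n → (suc n C suc k) · (x ^ᶠ suc k *ᶠ y ^ᶠ (n ∸ k)) ≈ x ^ᶠ suc n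
        top k refl = begin
          (suc n C suc n) · (x ^ᶠ suc n *ᶠ y ^ᶠ (n ∸ n))  ≈⟨ ×-congˡ (nCn≡1 (suc n)) ⟩
          1 · (x ^ᶠ suc n *ᶠ y ^ᶠ (n ∸ n))                ≈⟨ ×-homo-1 _ ⟩
          x ^ᶠ suc n *ᶠ y ^ᶠ (n ∸ n)                      ≈⟨ *-congˡ (^-cong {x = y} ≈-refl (ℕ.n∸n≡0 n)) ⟩
          x ^ᶠ suc n *ᶠ 1#                                ≈⟨ *-identityʳ _ ⟩
          x ^ᶠ suc n                                      ∎

  [x+y]^p^e≈x^p^e+y^p^e : ∀ e x y → (x +ᶠ y) ^ᶠ (p ^ e) ≈ x ^ᶠ (p ^ e) +ᶠ y ^ᶠ (p ^ e)
  [x+y]^p^e≈x^p^e+y^p^e zero    x y = ≈-trans (*-identityʳ _) (≈-sym (+-cong (*-identityʳ x) (*-identityʳ y)))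
  [x+y]^p^e≈x^p^e+y^p^e (suc e) x y = begin
    (x +ᶠ y) ^ᶠ (p * p ^ e)                     ≈⟨ ^-assocʳ (x +ᶠ y) p (p ^ e) ⟨
    ((x +ᶠ y) ^ᶠ p) ^ᶠ (p ^ e)                  ≈⟨ ^-congˡ (p ^ e) ([x+y]^p≈x^p+y^p x y) ⟩
    (x ^ᶠ p +ᶠ y ^ᶠ p) ^ᶠ (p ^ e)               ≈⟨ [x+y]^p^e≈x^p^e+y^p^e e (x ^ᶠ p) (y ^ᶠ p) ⟩
    (x ^ᶠ p) ^ᶠ (p ^ e) +ᶠ (y ^ᶠ p) ^ᶠ (p ^ e)  ≈⟨ +-cong (^-assocʳ x p (p ^ e)) (^-assocʳ y p (p ^ e)) ⟩
    x ^ᶠ (p * p ^ e) +ᶠ y ^ᶠ (p * p ^ e)        ∎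
    where open ≈R

  twistedFrobenius : ℕ → Carrier → AdditiveMap
  twistedFrobenius e a = record
    { ⟦_⟧     = λ v → a *ᶠ v ^ᶠ (p ^ e) -ᶠ v
    ; ⟦⟧-cong = λ u≈v → +-cong (*-congˡ (^-congˡ (p ^ e) u≈v)) (-‿cong u≈v)
    ; ⟦⟧-+    = λ u v → begin
        a *ᶠ (u +ᶠ v) ^ᶠ N -ᶠ (u +ᶠ v)
          ≈⟨ +-cong (*-congˡ ([x+y]^p^e≈x^p^e+y^p^e e u v)) (≈-sym (-‿+-comm u v)) ⟩
        a *ᶠ (u ^ᶠ N +ᶠ v ^ᶠ N) +ᶠ (- u -ᶠ v)
          ≈⟨ solve 5 (λ a x y u v → a :* (x :+ y) :+ (u :+ v) := (a :* x :+ u) :+ (a :* y :+ v)) ≈-refl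
               a (u ^ᶠ N) (v ^ᶠ N) (- u) (- v) ⟩
        (a *ᶠ u ^ᶠ N -ᶠ u) +ᶠ (a *ᶠ v ^ᶠ N -ᶠ v) ∎
    }
    where
    open ≈R
    N = p ^ e

-- Fibres of Λ over a single point

module FibreSizes
  {c ℓ} (p e h m : ℕ) (p-prime : Prime p) (1≤e : 1 ≤ e) (1≤h : 1 ≤ h) (h∣pᵉ-1 : h ∣ p ^ e ∸ 1)
  (F : FiniteField c ℓ (p ^ m))
  where

  open Parameters p e h m p-prime 1≤e 1≤h h∣pᵉ-1
  open Fibres F hiding (Carrier; _≈_; _≟_; #; elements)
  open Frobenius {m = m} p-prime F
  private module ≈R = SetoidReasoning setoid

  A*h≡N∸1 : A * h ≡ N ∸ 1
  A*h≡N∸1 = m/n*n≡m {{h≢0}} h∣pᵉ-1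

  1<N : 1 < N
  1<N = ℕ.<-≤-trans 1<s (ℕ.^-monoʳ-≤ p {{p≢0}} (∣⇒≤ {{>-nonZero 1≤e}} (gcd[m,n]∣m e m)))

  suc[N∸1]≡N : suc (N ∸ 1) ≡ N
  suc[N∸1]≡N = ℕ.m+[n∸m]≡n (ℕ.<⇒≤ 1<N)

  instance
    N∸1≢0 : NonZero (N ∸ 1)
    N∸1≢0 = >-nonZero (ℕ.m<n⇒0<n∸m 1<N)

    A≢0 : NonZero A
    A≢0 = ℕ.m*n≢0⇒m≢0 A {{subst NonZero (sym A*h≡N∸1) N∸1≢0}}

    h-nonZero : NonZero h
    h-nonZero = h≢0

  gcd[N∸1,Q∸1]≡s∸1 : gcd (N ∸ 1) (Q ∸ 1) ≡ s ∸ 1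
  gcd[N∸1,Q∸1]≡s∸1 = gcd[x^m∸1,x^n∸1]≡x^gcd∸1 p {{p≢0}} e m

  ρ*h≡κ*[s∸1] : ρ * h ≡ κ * (s ∸ 1)
  ρ*h≡κ*[s∸1] = m/n*n≡m {{h≢0}} h∣κ[s-1]

  -- Both sides equal gcd(h (s - 1), N - 1), since N - 1 is (s - 1) C as well as h A.
  κ*[s∸1]≡h*gcd[s∸1,A] : κ * (s ∸ 1) ≡ h * gcd (s ∸ 1) A
  κ*[s∸1]≡h*gcd[s∸1,A] = begin
    κ * (s ∸ 1)                           ≡⟨ ℕ.*-comm κ (s ∸ 1) ⟩
    (s ∸ 1) * κ                           ≡⟨ c*gcd[m,n]≡gcd[cm,cn] (s ∸ 1) h C ⟩
    gcd ((s ∸ 1) * h) ((s ∸ 1) * C)       ≡⟨ cong₂ gcd (ℕ.*-comm (s ∸ 1) h) (m*[n/m]≡n {{s-1≢0}} s-1∣N-1) ⟩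
    gcd (h * (s ∸ 1)) (N ∸ 1)             ≡⟨ cong (gcd (h * (s ∸ 1))) (trans (sym A*h≡N∸1) (ℕ.*-comm A h)) ⟩
    gcd (h * (s ∸ 1)) (h * A)             ≡⟨ c*gcd[m,n]≡gcd[cm,cn] h (s ∸ 1) A ⟨
    h * gcd (s ∸ 1) A                     ∎
    where open ≡-Reasoning

  -- As A divides N - 1, a common divisor of A and Q - 1 divides gcd(N - 1, Q - 1) = s - 1;
  -- conversely s - 1 divides Q - 1. So Q - 1 may be replaced by s - 1, and cancelling h gives ρ.
  gcd[A,Q∸1]≡ρ : gcd A (Q ∸ 1) ≡ ρ
  gcd[A,Q∸1]≡ρ = begin
    gcd A (Q ∸ 1)       ≡⟨ ∣-antisym
      (gcd-greatest (subst (gcd A (Q ∸ 1) ∣_) gcd[N∸1,Q∸1]≡s∸1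
                      (gcd-greatest (∣-trans (gcd[m,n]∣m A _) A∣N∸1) (gcd[m,n]∣n A _)))
                    (gcd[m,n]∣m A _))
      (gcd-greatest (gcd[m,n]∣n (s ∸ 1) A) (∣-trans (gcd[m,n]∣m (s ∸ 1) A) s∸1∣Q∸1)) ⟩
    gcd (s ∸ 1) A
      ≡⟨ ℕ.*-cancelʳ-≡ ρ (gcd (s ∸ 1) A) h (trans ρ*h≡κ*[s∸1] (trans κ*[s∸1]≡h*gcd[s∸1,A] (ℕ.*-comm h _))) ⟨
    ρ                   ∎
    where
    open ≡-Reasoning
    A∣N∸1 : A ∣ N ∸ 1
    A∣N∸1 = divides h (trans (sym A*h≡N∸1) (ℕ.*-comm A h))
    s∸1∣Q∸1 : s ∸ 1 ∣ Q ∸ 1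
    s∸1∣Q∸1 = subst (_∣ Q ∸ 1) gcd[N∸1,Q∸1]≡s∸1 (gcd[m,n]∣n (N ∸ 1) (Q ∸ 1))

  Λ-cong : ∀ {u v} → u ≈ v → Λ u ≈ Λ v
  Λ-cong u≈v = *-cong u≈v (^-congˡ h (+-congʳ (^-congˡ A u≈v)))

  -- A product in a field vanishes only with a factor, so u = 0 or u^A = 1; these exclude each other
  -- because A is positive.
  r[0]≡1+ρ : ∀ {t} → t ≈ 0# → r t ≡ 1 + ρ
  r[0]≡1+ρ {t} t≈0 = trans
    (#-⊎ (0# ≟_) (λ u → (u ^ᶠ A) ≟ 1#) (λ u → Λ u ≟ t)
      (λ 0≈u → ≈-trans (≈-trans (*-congʳ (≈-sym 0≈u)) (zeroˡ _)) (≈-sym t≈0))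
      (λ u^A≈1 → ≈-trans (≈-trans (*-congˡ (x≈0⇒x^n≈0 h (x≈y⇒x-y≈0 u^A≈1))) (zeroʳ _)) (≈-sym t≈0))
      split
      (λ 0≈u u^A≈1 → x^n≈1⇒x≉0 A u^A≈1 (≈-sym 0≈u)))
    (cong₂ _+_ (#-singleton 0#) (trans (#roots-of-unity A) gcd[A,Q∸1]≡ρ))
    where
    split : ∀ {u} → Λ u ≈ t → 0# ≈ u ⊎ u ^ᶠ A ≈ 1#
    split {u} Λu≈t with u ≟ 0# | (u ^ᶠ A) ≟ 1#
    ... | yes u≈0 | _         = inj₁ (≈-sym u≈0)
    ... | no _    | yes u^A≈1 = inj₂ u^A≈1
    ... | no u≉0  | no u^A≉1  = contradiction (≈-trans Λu≈t t≈0)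
      (x*y≉0 u≉0 (x^n≉0 h (u^A≉1 ∘ x-y≈0⇒x≈y (u ^ᶠ A) 1#)))

  twist : Carrier → AdditiveMap
  twist t = twistedFrobenius e (t ^ᶠ A)

  module _ {t} (t≉0 : ¬ t ≈ 0#) where

    open AdditiveMap (twist t)
    open ≈R

    -- The place where h A = N - 1 enters: v^N = v (v^h)^A, so the factor t^A combines with (v^h)^A
    -- to u^A.
    t^Av^N≈u^Av : ∀ {u v} → u ≈ t *ᶠ v ^ᶠ h → t ^ᶠ A *ᶠ v ^ᶠ N ≈ u ^ᶠ A *ᶠ v
    t^Av^N≈u^Av {u} {v} u≈tv^h = begin
      t ^ᶠ A *ᶠ v ^ᶠ N
        ≡⟨ cong (λ n → t ^ᶠ A *ᶠ v ^ᶠ n) (trans (sym suc[N∸1]≡N) (cong suc (trans (sym A*h≡N∸1) (ℕ.*-comm A h)))) ⟩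
      t ^ᶠ A *ᶠ (v *ᶠ v ^ᶠ (h * A))     ≈⟨ *-congˡ (*-congˡ (^-assocʳ v h A)) ⟨
      t ^ᶠ A *ᶠ (v *ᶠ (v ^ᶠ h) ^ᶠ A)
        ≈⟨ solve 3 (λ x y z → x :* (y :* z) := x :* z :* y) ≈-refl (t ^ᶠ A) v ((v ^ᶠ h) ^ᶠ A) ⟩
      t ^ᶠ A *ᶠ (v ^ᶠ h) ^ᶠ A *ᶠ v      ≈⟨ *-congʳ (^-distrib-* t (v ^ᶠ h) A) ⟨
      (t *ᶠ v ^ᶠ h) ^ᶠ A *ᶠ v           ≈⟨ *-congʳ (^-congˡ A u≈tv^h) ⟨
      u ^ᶠ A *ᶠ v                       ∎

    [u^A-1]v≈⟦v⟧ : ∀ {u v} → u ≈ t *ᶠ v ^ᶠ h → (u ^ᶠ A -ᶠ 1#) *ᶠ v ≈ ⟦ v ⟧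
    [u^A-1]v≈⟦v⟧ {u} {v} u≈tv^h = begin
      (u ^ᶠ A -ᶠ 1#) *ᶠ v               ≈⟨ distribʳ v (u ^ᶠ A) (- 1#) ⟩
      u ^ᶠ A *ᶠ v +ᶠ - 1# *ᶠ v          ≈⟨ +-cong (≈-sym (t^Av^N≈u^Av u≈tv^h)) (-1*x≈-x v) ⟩
      ⟦ v ⟧                             ∎

    -- Fibres correspond under v = 1 / (u^A - 1) and u = t v^h.
    r≡#fibre : r t ≡ # (λ v → ⟦ v ⟧ ≟ 1#)
    r≡#fibre = ℕ.≤-antisym
      (#-injection (λ u → Λ u ≟ t) (λ v → ⟦ v ⟧ ≟ 1#) (λ x≈y → ≈-trans (⟦⟧-cong (≈-sym x≈y)))
        to (λ {u} Λu≈t → ≈-trans (≈-sym ([u^A-1]v≈⟦v⟧ (u≈t[to-u]^h Λu≈t))) (w*to≈1 Λu≈t))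
        (λ Λu≈t Λu′≈t eq → ≈-trans (u≈t[to-u]^h Λu≈t)
          (≈-trans (*-congˡ (^-congˡ h eq)) (≈-sym (u≈t[to-u]^h Λu′≈t)))))
      (#-injection (λ v → ⟦ v ⟧ ≟ 1#) (λ u → Λ u ≟ t) (λ x≈y → ≈-trans (Λ-cong (≈-sym x≈y)))
        from Λ-from
        -- Both v and v′ are inverse to u^A - 1 for the common value u, hence equal.
        (λ {v} {v′} ⟦v⟧≈1 ⟦v′⟧≈1 eq → *-inverse-unique
          (≈-trans ([u^A-1]v≈⟦v⟧ ≈-refl) ⟦v⟧≈1)
          (≈-trans ([u^A-1]v≈⟦v⟧ {v = v′} eq) ⟦v′⟧≈1)))
      where
      to from : Carrier → Carrier
      to u   = inverse (u ^ᶠ A -ᶠ 1#)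
      from v = t *ᶠ v ^ᶠ h
      w*to≈1 : ∀ {u} → Λ u ≈ t → (u ^ᶠ A -ᶠ 1#) *ᶠ to u ≈ 1#
      w*to≈1 Λu≈t = x*inverse≈1 λ w≈0 →
        t≉0 (≈-trans (≈-sym Λu≈t) (≈-trans (*-congˡ (x≈0⇒x^n≈0 h w≈0)) (zeroʳ _)))
      cancel : ∀ {w v} x → w *ᶠ v ≈ 1# → x *ᶠ w ^ᶠ h *ᶠ v ^ᶠ h ≈ x
      cancel {w} {v} x wv≈1 = begin
        x *ᶠ w ^ᶠ h *ᶠ v ^ᶠ h     ≈⟨ *-assoc _ _ _ ⟩
        x *ᶠ (w ^ᶠ h *ᶠ v ^ᶠ h)   ≈⟨ *-congˡ (^-distrib-* w v h) ⟨
        x *ᶠ (w *ᶠ v) ^ᶠ h        ≈⟨ *-congˡ (≈-trans (^-congˡ h wv≈1) (1^n≈1 h)) ⟩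
        x *ᶠ 1#                   ≈⟨ *-identityʳ x ⟩
        x                         ∎
      u≈t[to-u]^h : ∀ {u} → Λ u ≈ t → u ≈ t *ᶠ to u ^ᶠ h
      u≈t[to-u]^h {u} Λu≈t = ≈-trans (≈-sym (cancel u (w*to≈1 Λu≈t))) (*-congʳ Λu≈t)
      Λ-from : ∀ {v} → ⟦ v ⟧ ≈ 1# → Λ (from v) ≈ t
      Λ-from {v} ⟦v⟧≈1 = cancel t (≈-trans (*-comm v _) (≈-trans ([u^A-1]v≈⟦v⟧ ≈-refl) ⟦v⟧≈1))

  -- The pairs (t, w) with t^A w^(N-1) = 1

  twistedRoot? : ∀ t → U.Decidable (λ w → t ^ᶠ A *ᶠ w ^ᶠ (N ∸ 1) ≈ 1#)
  twistedRoot? t w = (t ^ᶠ A *ᶠ w ^ᶠ (N ∸ 1)) ≟ 1#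

  #twistedRoots : Carrier → ℕ
  #twistedRoots t = # (twistedRoot? t)

  twist-factors : ∀ t v → let open AdditiveMap (twist t) in
    ⟦ v ⟧ ≈ v *ᶠ (t ^ᶠ A *ᶠ v ^ᶠ (N ∸ 1) -ᶠ 1#)
  twist-factors t v = begin
    t ^ᶠ A *ᶠ v ^ᶠ N -ᶠ v
      ≡⟨ cong (λ n → t ^ᶠ A *ᶠ v ^ᶠ n -ᶠ v) suc[N∸1]≡N ⟨
    t ^ᶠ A *ᶠ (v *ᶠ v ^ᶠ (N ∸ 1)) -ᶠ v
      ≈⟨ +-cong (solve 3 (λ x y z → x :* (y :* z) := y :* (x :* z)) ≈-refl (t ^ᶠ A) v (v ^ᶠ (N ∸ 1)))
                (≈-sym (≈-trans (*-comm v _) (-1*x≈-x v))) ⟩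
    v *ᶠ (t ^ᶠ A *ᶠ v ^ᶠ (N ∸ 1)) +ᶠ v *ᶠ - 1#
      ≈⟨ distribˡ v _ _ ⟨
    v *ᶠ (t ^ᶠ A *ᶠ v ^ᶠ (N ∸ 1) -ᶠ 1#) ∎
    where open ≈R

  twist-kernel : ∀ t {v} → let open AdditiveMap (twist t) in
    ⟦ v ⟧ ≈ 0# → 0# ≈ v ⊎ t ^ᶠ A *ᶠ v ^ᶠ (N ∸ 1) ≈ 1#
  twist-kernel t {v} ⟦v⟧≈0 with v ≟ 0#
  ... | yes v≈0 = inj₁ (≈-sym v≈0)
  ... | no v≉0  = inj₂ (x-y≈0⇒x≈y _ _ (x*y≈0⇒y≈0 v≉0 (≈-trans (≈-sym (twist-factors t v)) ⟦v⟧≈0)))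

  kernelSize≡1+#twistedRoots : ∀ t → AdditiveMap.kernelSize (twist t) ≡ 1 + #twistedRoots t
  kernelSize≡1+#twistedRoots t = trans
    (#-⊎ (0# ≟_) (twistedRoot? t) (λ v → ⟦ v ⟧ ≟ 0#)
      (λ {v} 0≈v → ≈-trans (twist-factors t v) (≈-trans (*-congʳ (≈-sym 0≈v)) (zeroˡ _)))
      (λ {v} root → ≈-trans (twist-factors t v) (≈-trans (*-congˡ (x≈y⇒x-y≈0 root)) (zeroʳ v)))
      (twist-kernel t)
      (λ 0≈v root → x*y≈1⇒x≉0 (≈-trans (*-comm _ _) root) (x≈0⇒x^n≈0 (N ∸ 1) (≈-sym 0≈v))))
    (cong (_+ #twistedRoots t) (#-singleton 0#))
    where open AdditiveMap (twist t)

  -- The witness is t = w^(-h), whose A-th power is w^(-(N-1)).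
  columnRoot : ∀ {w} → ¬ w ≈ 0# → w ^ᶠ (N ∸ 1) *ᶠ (inverse w ^ᶠ h) ^ᶠ A ≈ 1#
  columnRoot {w} w≉0 = begin
    w ^ᶠ (N ∸ 1) *ᶠ (inverse w ^ᶠ h) ^ᶠ A         ≈⟨ *-congˡ (^-assocʳ (inverse w) h A) ⟩
    w ^ᶠ (N ∸ 1) *ᶠ inverse w ^ᶠ (h * A)
      ≡⟨ cong (λ n → w ^ᶠ (N ∸ 1) *ᶠ inverse w ^ᶠ n) (trans (ℕ.*-comm h A) A*h≡N∸1) ⟩
    w ^ᶠ (N ∸ 1) *ᶠ inverse w ^ᶠ (N ∸ 1)          ≈⟨ ^-distrib-* w (inverse w) (N ∸ 1) ⟨
    (w *ᶠ inverse w) ^ᶠ (N ∸ 1)                   ≈⟨ ^-congˡ (N ∸ 1) (x*inverse≈1 w≉0) ⟩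
    1# ^ᶠ (N ∸ 1)                                 ≈⟨ 1^n≈1 (N ∸ 1) ⟩
    1#                                            ∎
    where open ≈R

  -- For fixed nonzero w the admissible t form a coset of the A-th roots of unity, of size ρ; w = 0
  -- admits none.
  ∑-#twistedRoots : ∑ #twistedRoots ≡ (Q ∸ 1) * ρ
  ∑-#twistedRoots = begin
    ∑ #twistedRoots                                 ≡⟨ ∑-# twistedRoot? ⟩
    ∑ (λ w → # (λ t → twistedRoot? t w))            ≡⟨ ∑-cong column ⟩
    ∑ (λ w → ind (¬? (w ≟ 0#)) * ρ)                 ≡⟨ ∑-*ʳ (λ w → ind (¬? (w ≟ 0#))) ρ ⟩
    ∑ (λ w → ind (¬? (w ≟ 0#))) * ρ                 ≡⟨ cong (_* ρ) (#≡∑ (λ w → ¬? (w ≟ 0#))) ⟨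
    # (λ w → ¬? (w ≟ 0#)) * ρ                       ≡⟨ cong (_* ρ) #nonzero ⟩
    (Q ∸ 1) * ρ                                     ∎
    where
    open ≡-Reasoning
    column : ∀ w → # (λ t → twistedRoot? t w) ≡ ind (¬? (w ≟ 0#)) * ρ
    column w = case w ≟ 0# of (λ where
      (yes w≈0) → trans
        (#-∅ (λ t → twistedRoot? t w) λ t root → x*y≈1⇒x≉0 (≈-trans (*-comm _ _) root) (x≈0⇒x^n≈0 (N ∸ 1) w≈0))
        (cong (_* ρ) (sym (ind-no (¬? (w ≟ 0#)) λ w≉0 → w≉0 w≈0)))
      (no w≉0) → trans
        (#-cong (λ t → twistedRoot? t w) (λ t → (w ^ᶠ (N ∸ 1) *ᶠ t ^ᶠ A) ≟ 1#)
          (λ t → ≈-trans (*-comm _ _)) (λ t → ≈-trans (*-comm _ _)))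
        (trans (#twisted-roots-of-unity A (columnRoot w≉0))
          (trans gcd[A,Q∸1]≡ρ (trans (sym (ℕ.*-identityˡ ρ))
            (cong (_* ρ) (sym (ind-yes (¬? (w ≟ 0#)) w≉0)))))))

  -- Besides t = 0: trivial kernel (`single`), or nontrivial kernel with 1 outside (`missed`) or
  -- inside (`full`) the image of the additive map. Fibre sizes and root counts are functions of the
  -- class, so every sum over t becomes a linear combination of the class sizes.
  data Class : Set where
    origin missed single full : Class

  fibreSize #rootsIn isOrigin isMissed isSingle isFull : Class → ℕ

  fibreSize origin = 1 + ρ
  fibreSize missed = 0
  fibreSize single = 1
  fibreSize full   = s

  #rootsIn origin = 0
  #rootsIn missed = s ∸ 1
  #rootsIn single = 0
  #rootsIn full   = s ∸ 1

  isOrigin origin = 1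
  isOrigin _      = 0

  isMissed missed = 1
  isMissed _      = 0

  isSingle single = 1
  isSingle _      = 0

  isFull full = 1
  isFull _    = 0

  record Classification (t : Carrier) : Set where
    constructor classified
    field
      class            : Class
      r≡fibreSize      : r t ≡ fibreSize class
      #twistedRoots≡   : #twistedRoots t ≡ #rootsIn class
      ind-origin       : ind (t ≟ 0#) ≡ isOrigin class

  classify : ∀ t → Classification t
  classify t = case t ≟ 0# of (λ where
      (yes t≈0) → classified origin (r[0]≡1+ρ t≈0)
        (#-∅ (twistedRoot? t) λ w root → x*y≈1⇒x≉0 root (x≈0⇒x^n≈0 A t≈0)) (ind-yes (t ≟ 0#) t≈0)
      (no t≉0) → case find (twistedRoot? t) (λ x≈y → ≈-trans (*-congˡ (^-congˡ (N ∸ 1) (≈-sym x≈y)))) of λ where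
        (no ∄root) → classified single
          (trans (r≡#fibre t≉0) (trivialKernel⇒#fibre≡1 (trivial ∄root) 1#))
          (#-∅ (twistedRoot? t) λ w root → ∄root (w , root)) (ind-no (t ≟ 0#) t≉0)
        -- The kernel now has s elements. Whether 1 is a value of the additive map is settled by
        -- search; only the totals of the two outcomes are computed later.
        (yes (w , root)) → case find (λ v → ⟦ v ⟧ ≟ 1#) (λ x≈y → ≈-trans (⟦⟧-cong (≈-sym x≈y))) of λ where
          (no ∄v) → classified missed
            (trans (r≡#fibre t≉0) (#-∅ (λ v → ⟦ v ⟧ ≟ 1#) λ v eq → ∄v (v , eq)))
            (#roots root) (ind-no (t ≟ 0#) t≉0)
          (yes (v , ⟦v⟧≈1)) → classified full
            (trans (r≡#fibre t≉0) (trans (#fibre≡kernelSize ⟦v⟧≈1) (trans (kernelSize≡1+#twistedRoots t)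
              (trans (cong suc (#roots root)) (ℕ.m+[n∸m]≡n (ℕ.<⇒≤ 1<s))))))
            (#roots root) (ind-no (t ≟ 0#) t≉0))
    where
    open AdditiveMap (twist t)
    #roots : ∀ {w} → t ^ᶠ A *ᶠ w ^ᶠ (N ∸ 1) ≈ 1# → #twistedRoots t ≡ s ∸ 1
    #roots root = trans (#twisted-roots-of-unity (N ∸ 1) root) gcd[N∸1,Q∸1]≡s∸1
    trivial : ¬ (∃ λ w → t ^ᶠ A *ᶠ w ^ᶠ (N ∸ 1) ≈ 1#) → ∀ v → ⟦ v ⟧ ≈ 0# → v ≈ 0#
    trivial ∄root v ⟦v⟧≈0 = case twist-kernel t ⟦v⟧≈0 of λ where
      (inj₁ 0≈v)  → ≈-sym 0≈v
      (inj₂ root) → contradiction (v , root) ∄root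

  private
    class : Carrier → Class
    class t = Classification.class (classify t)

  -- Sums over the field, grouped by class

  #missed #single #full : ℕ
  #missed = ∑ (isMissed ∘ class)
  #single = ∑ (isSingle ∘ class)
  #full   = ∑ (isFull ∘ class)

  ∑-isOrigin : ∑ (isOrigin ∘ class) ≡ 1
  ∑-isOrigin = begin
    ∑ (isOrigin ∘ class)          ≡⟨ ∑-cong (λ t → sym (Classification.ind-origin (classify t))) ⟩
    ∑ (λ t → ind (t ≟ 0#))        ≡⟨ #≡∑ (_≟ 0#) ⟨
    # (_≟ 0#)                     ≡⟨ #-cong (_≟ 0#) (0# ≟_) (λ _ → ≈-sym) (λ _ → ≈-sym) ⟩
    # (0# ≟_)                     ≡⟨ #-singleton 0# ⟩
    1                             ∎
    where open ≡-Reasoning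

  ∑-by-class : (ψ : Class → ℕ) →
    ∑ (ψ ∘ class) ≡ ψ origin + #missed * ψ missed + #single * ψ single + #full * ψ full
  ∑-by-class ψ = begin
    ∑ (ψ ∘ class)
      ≡⟨ ∑-cong (λ t → split (class t)) ⟩
    ∑ (λ t → isOrigin (class t) * ψ origin + isMissed (class t) * ψ missed
             + isSingle (class t) * ψ single + isFull (class t) * ψ full)
      ≡⟨ trans (∑-+ (λ t → o t + m′ t + s′ t) f) (cong (_+ ∑ f) (trans (∑-+ (λ t → o t + m′ t) s′) (cong (_+ ∑ s′) (∑-+ o m′)))) ⟩
    ∑ o + ∑ m′ + ∑ s′ + ∑ f
      ≡⟨ cong₂ _+_ (cong₂ _+_ (cong₂ _+_ (trans (∑-*ʳ (isOrigin ∘ class) (ψ origin))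
             (trans (cong (_* ψ origin) ∑-isOrigin) (ℕ.*-identityˡ _)))
           (∑-*ʳ (isMissed ∘ class) (ψ missed))) (∑-*ʳ (isSingle ∘ class) (ψ single)))
           (∑-*ʳ (isFull ∘ class) (ψ full)) ⟩
    ψ origin + #missed * ψ missed + #single * ψ single + #full * ψ full ∎
    where
    open ≡-Reasoning
    o m′ s′ f : Carrier → ℕ
    o t  = isOrigin (class t) * ψ origin
    m′ t = isMissed (class t) * ψ missed
    s′ t = isSingle (class t) * ψ single
    f t  = isFull (class t) * ψ full
    split : ∀ k → ψ k ≡ isOrigin k * ψ origin + isMissed k * ψ missed + isSingle k * ψ single + isFull k * ψ full
    split origin = sym (trans (ℕ.+-identityʳ _) (trans (ℕ.+-identityʳ _) (trans (ℕ.+-identityʳ _) (ℕ.+-identityʳ _))))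
    split missed = sym (trans (ℕ.+-identityʳ _) (trans (ℕ.+-identityʳ _) (ℕ.+-identityʳ _)))
    split single = sym (trans (ℕ.+-identityʳ _) (ℕ.+-identityʳ _))
    split full   = sym (ℕ.+-identityʳ _)

  -- The common source of the results: φ is the identity for the total size of the fibres,
  -- truncation at 1 for the image, the indicator of k for the enumerator and a power for the
  -- moments.
  ∑-r : (φ : ℕ → ℕ) → ∑ (φ ∘ r) ≡ φ (1 + ρ) + #missed * φ 0 + #single * φ 1 + #full * φ s
  ∑-r φ = trans (∑-cong λ t → cong φ (Classification.r≡fibreSize (classify t))) (∑-by-class (φ ∘ fibreSize))

  points-counted : 1 + #missed + #single + #full ≡ Q
  points-counted = begin
    1 + #missed + #single + #full
      ≡⟨ cong₂ _+_ (cong₂ _+_ (cong suc (ℕ.*-identityʳ #missed)) (ℕ.*-identityʳ #single)) (ℕ.*-identityʳ #full) ⟨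
    1 + #missed * 1 + #single * 1 + #full * 1   ≡⟨ ∑-by-class (λ _ → 1) ⟨
    ∑ (λ _ → 1)                                 ≡⟨ trans (∑-const 1) (ℕ.*-identityʳ Q) ⟩
    Q                                           ∎
    where open ≡-Reasoning

  twistedRoots-counted : (#missed + #full) * (s ∸ 1) ≡ (Q ∸ 1) * ρ
  twistedRoots-counted = begin
    (#missed + #full) * (s ∸ 1)
      ≡⟨ ℕ.*-distribʳ-+ (s ∸ 1) #missed #full ⟩
    #missed * (s ∸ 1) + #full * (s ∸ 1)
      ≡⟨ cong (_+ #full * (s ∸ 1)) (trans (cong (λ n → #missed * (s ∸ 1) + n) (ℕ.*-zeroʳ #single)) (ℕ.+-identityʳ _)) ⟨
    0 + #missed * (s ∸ 1) + #single * 0 + #full * (s ∸ 1)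
      ≡⟨ ∑-by-class #rootsIn ⟨
    ∑ (#rootsIn ∘ class)
      ≡⟨ ∑-cong (λ t → sym (Classification.#twistedRoots≡ (classify t))) ⟩
    ∑ #twistedRoots
      ≡⟨ ∑-#twistedRoots ⟩
    (Q ∸ 1) * ρ ∎
    where open ≡-Reasoning

  arguments-counted : 1 + ρ + #single + #full * s ≡ Q
  arguments-counted = begin
    1 + ρ + #single + #full * s
      ≡⟨ cong (_+ #full * s) (cong₂ _+_ (trans (cong (λ n → 1 + ρ + n) (ℕ.*-zeroʳ #missed)) (ℕ.+-identityʳ _)) (ℕ.*-identityʳ #single)) ⟨
    1 + ρ + #missed * 0 + #single * 1 + #full * s   ≡⟨ ∑-r id ⟨
    ∑ r                                             ≡⟨ ∑-preimages Λ ⟩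
    Q                                               ∎
    where open ≡-Reasoning

  -- The indicator of the image at t is `1 ⊓ r t`, a function of the fibre size.
  #image : # inImage? ≡ 1 + #single + #full
  #image = begin
    # inImage?
      ≡⟨ trans (#≡∑ inImage?) (∑-cong attained) ⟩
    ∑ (λ t → 1 ⊓ r t)
      ≡⟨ ∑-r (1 ⊓_) ⟩
    1 + #missed * 0 + #single * 1 + #full * (1 ⊓ s)
      ≡⟨ cong₂ _+_ (cong₂ _+_ (trans (cong suc (ℕ.*-zeroʳ #missed)) refl) (ℕ.*-identityʳ #single))
           (trans (cong (#full *_) (ℕ.m≤n⇒m⊓n≡m (ℕ.<⇒≤ 1<s))) (ℕ.*-identityʳ #full)) ⟩
    1 + #single + #full ∎
    where
    open ≡-Reasoning
    1≤r : ∀ {t} → InImage t → 1 ≤ r t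
    1≤r {t} (u , Λu≈t) = subst (_≤ r t) (#-singleton u)
      (#-mono (u ≟_) (λ v → Λ v ≟ t) λ v u≈v → ≈-trans (Λ-cong (≈-sym u≈v)) Λu≈t)
    attained : ∀ t → ind (inImage? t) ≡ 1 ⊓ r t
    attained t = case inImage? t of (λ where
      (yes t∈Λ) → trans (ind-yes (inImage? t) t∈Λ) (sym (ℕ.m≤n⇒m⊓n≡m (1≤r t∈Λ)))
      (no t∉Λ)  → trans (ind-no (inImage? t) t∉Λ)
        (cong (1 ⊓_) (sym (#-∅ (λ u → Λ u ≟ t) λ u Λu≈t → t∉Λ (u , Λu≈t)))))

-- Rational arithmetic and coefficients of the enumerator

toℚᵘ-/ : ∀ z d → ℚ.toℚᵘ (z ℚ./ suc d) ℚᵘ.≃ mkℚᵘ z d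
toℚᵘ-/ z d = ℚ.toℚᵘ-fromℚᵘ (mkℚᵘ z d)

-- Normalising a fraction with a variable numerator does not compute, so the identity is checked on
-- unnormalised fractions and pulled back along the injective `toℚᵘ`.
fromℕ-+ : ∀ m n → fromℕ (m + n) ≡ fromℕ m ℚ.+ fromℕ n
fromℕ-+ m n = ℚ.toℚᵘ-injective (begin
  ℚ.toℚᵘ (fromℕ (m + n))                         ≈⟨ toℚᵘ-/ (+ (m + n)) 0 ⟩
  mkℚᵘ (+ (m + n)) 0
    ≈⟨ *≡* (cong (ℤ._* + 1) (cong₂ ℤ._+_ (ℤ.*-identityʳ (+ m)) (ℤ.*-identityʳ (+ n)))) ⟨
  mkℚᵘ (+ m) 0 ℚᵘ.+ mkℚᵘ (+ n) 0                 ≈⟨ ℚᵘ.+-cong (toℚᵘ-/ (+ m) 0) (toℚᵘ-/ (+ n) 0) ⟨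
  ℚ.toℚᵘ (fromℕ m) ℚᵘ.+ ℚ.toℚᵘ (fromℕ n)         ≈⟨ ℚ.toℚᵘ-homo-+ (fromℕ m) (fromℕ n) ⟨
  ℚ.toℚᵘ (fromℕ m ℚ.+ fromℕ n)                   ∎)
  where open ℚᵘ.≃-Reasoning

[m*n]/d≡n*[m/d] : ∀ m n d .{{_ : NonZero d}} → + (m * n) ℚ./ d ≡ fromℕ n ℚ.* (+ m ℚ./ d)
[m*n]/d≡n*[m/d] m n (suc d) = ℚ.toℚᵘ-injective (begin
  ℚ.toℚᵘ (+ (m * n) ℚ./ suc d)                   ≈⟨ toℚᵘ-/ (+ (m * n)) d ⟩
  mkℚᵘ (+ (m * n)) d
    ≈⟨ *≡* (cong₂ ℤ._*_ (trans (ℤ.pos-* m n) (ℤ.*-comm (+ m) (+ n))) (cong (λ k → + suc k) (ℕ.+-identityʳ d))) ⟩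
  mkℚᵘ (+ n) 0 ℚᵘ.* mkℚᵘ (+ m) d                 ≈⟨ ℚᵘ.*-cong (toℚᵘ-/ (+ n) 0) (toℚᵘ-/ (+ m) d) ⟨
  ℚ.toℚᵘ (fromℕ n) ℚᵘ.* ℚ.toℚᵘ (+ m ℚ./ suc d)   ≈⟨ ℚ.toℚᵘ-homo-* (fromℕ n) (+ m ℚ./ suc d) ⟨
  ℚ.toℚᵘ (fromℕ n ℚ.* (+ m ℚ./ suc d))           ∎)
  where open ℚᵘ.≃-Reasoning

fromℕ-* : ∀ m n → fromℕ (m * n) ≡ fromℕ m ℚ.* fromℕ n
fromℕ-* m n = trans (cong fromℕ (ℕ.*-comm m n)) ([m*n]/d≡n*[m/d] n m 1)

-- The numerator is an arbitrary integer `z` because those of `M₁` and `Mₛ` contain integer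
-- subtractions.
[n*d]/d≡n : ∀ n d .{{_ : NonZero d}} {z} → z ≡ + (n * d) → z ℚ./ d ≡ fromℕ n
[n*d]/d≡n n (suc d) refl = ℚ.fromℚᵘ-cong {mkℚᵘ (+ (n * suc d)) d} {mkℚᵘ (+ n) 0}
  (*≡* (trans (ℤ.*-identityʳ _) (ℤ.pos-* n (suc d))))

x+y≡z⇒x≡z-y : ∀ {x y z : ℚ} → x ℚ.+ y ≡ z → x ≡ z ℚ.- y
x+y≡z⇒x≡z-y {x} {y} refl = sym (begin
  x ℚ.+ y ℚ.- y      ≡⟨ ℚ.+-assoc x y (ℚ.- y) ⟩
  x ℚ.+ (y ℚ.- y)    ≡⟨ cong (x ℚ.+_) (ℚ.+-inverseʳ y) ⟩
  x ℚ.+ 0ℚ           ≡⟨ ℚ.+-identityʳ x ⟩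
  x                  ∎)
  where open ≡-Reasoning

coeff-+ᴾ : ∀ f g k → coeff (f +ᴾ g) k ≡ coeff f k ℚ.+ coeff g k
coeff-+ᴾ []      g       k       = sym (ℚ.+-identityˡ (coeff g k))
coeff-+ᴾ (x ∷ f) []      k       = sym (ℚ.+-identityʳ (coeff (x ∷ f) k))
coeff-+ᴾ (x ∷ f) (y ∷ g) zero    = refl
coeff-+ᴾ (x ∷ f) (y ∷ g) (suc k) = coeff-+ᴾ f g k

coeff-·Z^ : ∀ x n k → coeff (x ·Z^ n) k ≡ x ℚ.* fromℕ (ind (n ℕ.≟ k))
coeff-·Z^ x zero    zero    = sym (ℚ.*-identityʳ x)
coeff-·Z^ x zero    (suc k) = sym (ℚ.*-zeroʳ x)
coeff-·Z^ x (suc n) zero    = sym (ℚ.*-zeroʳ x)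
coeff-·Z^ x (suc n) (suc k) = coeff-·Z^ x n k

-- Comparing coefficients turns the polynomial identity into a count for each k. The coincidence 1 +
-- ρ = s, which occurs when κ = h, then needs no separate case.
coeff-enumerator : ∀ {a} {A : Set a} (r : A → ℕ) xs k →
  coeff (sumᴾ (map (λ t → 1ℚ ·Z^ r t) xs)) k ≡ fromℕ (sum (map (λ t → ind (r t ℕ.≟ k)) xs))
coeff-enumerator r []       k = refl
coeff-enumerator r (x ∷ xs) k = begin
  coeff ((1ℚ ·Z^ r x) +ᴾ rest) k
    ≡⟨ coeff-+ᴾ (1ℚ ·Z^ r x) rest k ⟩
  coeff (1ℚ ·Z^ r x) k ℚ.+ coeff rest k
    ≡⟨ cong₂ ℚ._+_ (trans (coeff-·Z^ 1ℚ (r x) k) (ℚ.*-identityˡ (fromℕ (ind (r x ℕ.≟ k))))) (coeff-enumerator r xs k) ⟩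
  fromℕ (ind (r x ℕ.≟ k)) ℚ.+ fromℕ (sum (map (λ t → ind (r t ℕ.≟ k)) xs))
    ≡⟨ fromℕ-+ (ind (r x ℕ.≟ k)) _ ⟨
  fromℕ (ind (r x ℕ.≟ k) + sum (map (λ t → ind (r t ℕ.≟ k)) xs)) ∎
  where
  open ≡-Reasoning
  rest = sumᴾ (map (λ t → 1ℚ ·Z^ r t) xs)

m+n≡o⇒o-n≡m : ∀ m n {o} → m + n ≡ o → + o ℤ.- + n ≡ + m
m+n≡o⇒o-n≡m m n refl = begin
  + (m + n) ℤ.- + n         ≡⟨ ℤ.+-assoc (+ m) (+ n) (ℤ.- + n) ⟩
  + m ℤ.+ (+ n ℤ.- + n)     ≡⟨ cong (λ z → + m ℤ.+ z) (ℤ.+-inverseʳ (+ n)) ⟩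
  + m ℤ.+ + 0               ≡⟨ ℤ.+-identityʳ (+ m) ⟩
  + m                       ∎
  where open ≡-Reasoning

[m-n]*k≡o : ∀ m n k {o} → o + n * k ≡ m * k → (+ m ℤ.- + n) ℤ.* + k ≡ + o
[m-n]*k≡o m n k {o} eq = begin
  (+ m ℤ.- + n) ℤ.* + k               ≡⟨ ℤ.*-distribʳ-+ (+ k) (+ m) (ℤ.- + n) ⟩
  + m ℤ.* + k ℤ.+ ℤ.- + n ℤ.* + k     ≡⟨ cong (λ z → + m ℤ.* + k ℤ.+ z) (ℤ.neg-distribˡ-* (+ n) (+ k)) ⟨
  + m ℤ.* + k ℤ.- + n ℤ.* + k         ≡⟨ cong₂ ℤ._-_ (ℤ.pos-* m k) (ℤ.pos-* n k) ⟨
  + (m * k) ℤ.- + (n * k)             ≡⟨ m+n≡o⇒o-n≡m o (n * k) eq ⟩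
  + o                                 ∎
  where open ≡-Reasoning

-- n₀, n₁, nₛ are the numbers of t ≠ 0 with fibres of size 0, 1, s.  The three
-- equations count the points t, the pairs (t, w) with t^A w^(N-1) = 1, and the points u.
module FibreCounts
  {h κ ρ s Q n₀ n₁ nₛ : ℕ} (1<s : 1 < s) (ρ*h≡κ*[s∸1] : ρ * h ≡ κ * (s ∸ 1))
  (points : 1 + n₀ + n₁ + nₛ ≡ Q)
  (pairs  : (n₀ + nₛ) * (s ∸ 1) ≡ (Q ∸ 1) * ρ)
  (total  : 1 + ρ + n₁ + nₛ * s ≡ Q)
  where

  open +-*-Solver using (solve; _:+_; _:*_; _:=_; con)

  private
    s′ q′ : ℕ
    s′ = s ∸ 1
    q′ = Q ∸ 1

    1+s′≡s : suc s′ ≡ s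
    1+s′≡s = ℕ.m+[n∸m]≡n (ℕ.<⇒≤ 1<s)

    1+q′≡Q : suc q′ ≡ Q
    1+q′≡Q = trans (cong (λ x → suc (x ∸ 1)) (sym points)) points

    q′≡ : n₁ + (n₀ + nₛ) ≡ q′
    q′≡ = trans (solve 3 (λ a b c → b :+ (a :+ c) := a :+ b :+ c) refl n₀ n₁ nₛ) (cong (_∸ 1) points)

    instance
      s′≢0 : NonZero s′
      s′≢0 = >-nonZero (ℕ.m<n⇒0<n∸m 1<s)

    -- Multiplying the count of pairs by h turns ρ h into κ (s - 1), after which s - 1 cancels.
    h*[n₀+nₛ]≡κ*q′ : h * (n₀ + nₛ) ≡ κ * q′
    h*[n₀+nₛ]≡κ*q′ = ℕ.*-cancelʳ-≡ _ _ s′ (begin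
      h * (n₀ + nₛ) * s′     ≡⟨ ℕ.*-assoc h (n₀ + nₛ) s′ ⟩
      h * ((n₀ + nₛ) * s′)   ≡⟨ cong (h *_) pairs ⟩
      h * (q′ * ρ)           ≡⟨ solve 3 (λ h q ρ → h :* (q :* ρ) := q :* (ρ :* h)) refl h q′ ρ ⟩
      q′ * (ρ * h)           ≡⟨ cong (q′ *_) ρ*h≡κ*[s∸1] ⟩
      q′ * (κ * s′)          ≡⟨ solve 3 (λ q κ s → q :* (κ :* s) := κ :* q :* s) refl q′ κ s′ ⟩
      κ * q′ * s′            ∎)
      where open ≡-Reasoning

    -- Equating the count of points with the total of the fibres eliminates `n₁`.
    ρ+nₛ*s≡n₀+nₛ : ρ + nₛ * s ≡ n₀ + nₛ
    ρ+nₛ*s≡n₀+nₛ = ℕ.+-cancelˡ-≡ (suc n₁) _ _ (begin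
      suc n₁ + (ρ + nₛ * s)
        ≡⟨ solve 3 (λ n ρ x → con 1 :+ n :+ (ρ :+ x) := con 1 :+ ρ :+ n :+ x) refl n₁ ρ (nₛ * s) ⟩
      1 + ρ + n₁ + nₛ * s     ≡⟨ trans total (sym 1+q′≡Q) ⟩
      suc q′                  ≡⟨ cong suc q′≡ ⟨
      suc n₁ + (n₀ + nₛ)      ∎)
      where open ≡-Reasoning

    nₛ*[h*s]+κ*s′≡κ*q′ : nₛ * (h * s) + κ * s′ ≡ κ * q′
    nₛ*[h*s]+κ*s′≡κ*q′ = begin
      nₛ * (h * s) + κ * s′   ≡⟨ cong (λ x → nₛ * (h * s) + x) ρ*h≡κ*[s∸1] ⟨
      nₛ * (h * s) + ρ * h
        ≡⟨ solve 4 (λ n h s ρ → n :* (h :* s) :+ ρ :* h := h :* (ρ :+ n :* s)) refl nₛ h s ρ ⟩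
      h * (ρ + nₛ * s)        ≡⟨ cong (h *_) ρ+nₛ*s≡n₀+nₛ ⟩
      h * (n₀ + nₛ)           ≡⟨ h*[n₀+nₛ]≡κ*q′ ⟩
      κ * q′                  ∎
      where open ≡-Reasoning

  n₁*h+κ*[Q∸1]≡h*[Q∸1] : n₁ * h + κ * (Q ∸ 1) ≡ h * (Q ∸ 1)
  n₁*h+κ*[Q∸1]≡h*[Q∸1] = begin
    n₁ * h + κ * q′              ≡⟨ cong (λ x → n₁ * h + x) h*[n₀+nₛ]≡κ*q′ ⟨
    n₁ * h + h * (n₀ + nₛ)       ≡⟨ solve 3 (λ n h g → n :* h :+ h :* g := h :* (n :+ g)) refl n₁ h (n₀ + nₛ) ⟩
    h * (n₁ + (n₀ + nₛ))         ≡⟨ cong (h *_) q′≡ ⟩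
    h * q′                       ∎
    where open ≡-Reasoning

  nₛ*[h*s]+κ*s≡κ*Q : nₛ * (h * s) + κ * s ≡ κ * Q
  nₛ*[h*s]+κ*s≡κ*Q = begin
    nₛ * (h * s) + κ * s            ≡⟨ cong (λ x → nₛ * (h * s) + κ * x) 1+s′≡s ⟨
    nₛ * (h * s) + κ * suc s′
      ≡⟨ solve 3 (λ x κ s → x :+ κ :* (con 1 :+ s) := κ :+ (x :+ κ :* s)) refl (nₛ * (h * s)) κ s′ ⟩
    κ + (nₛ * (h * s) + κ * s′)     ≡⟨ cong (λ x → κ + x) nₛ*[h*s]+κ*s′≡κ*q′ ⟩
    κ + κ * q′                      ≡⟨ ℕ.*-suc κ q′ ⟨
    κ * suc q′                      ≡⟨ cong (κ *_) 1+q′≡Q ⟩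
    κ * Q                           ∎
    where open ≡-Reasoning

  n₀*[h*s]≡κ*[s∸1]*Q : n₀ * (h * s) ≡ κ * (s ∸ 1) * Q
  n₀*[h*s]≡κ*[s∸1]*Q = ℕ.+-cancelʳ-≡ (nₛ * (h * s)) _ _ (begin
    n₀ * (h * s) + nₛ * (h * s)
      ≡⟨ solve 4 (λ a b h s → a :* (h :* s) :+ b :* (h :* s) := h :* (a :+ b) :* s) refl n₀ nₛ h s ⟩
    h * (n₀ + nₛ) * s                         ≡⟨ cong₂ _*_ h*[n₀+nₛ]≡κ*q′ (sym 1+s′≡s) ⟩
    κ * q′ * suc s′                           ≡⟨ ℕ.*-suc (κ * q′) s′ ⟩
    κ * q′ + κ * q′ * s′                      ≡⟨ cong (_+ κ * q′ * s′) nₛ*[h*s]+κ*s′≡κ*q′ ⟨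
    nₛ * (h * s) + κ * s′ + κ * q′ * s′
      ≡⟨ solve 4 (λ x κ s q → x :+ κ :* s :+ κ :* q :* s := κ :* s :* (con 1 :+ q) :+ x) refl (nₛ * (h * s)) κ s′ q′ ⟩
    κ * s′ * suc q′ + nₛ * (h * s)            ≡⟨ cong (λ x → κ * s′ * x + nₛ * (h * s)) 1+q′≡Q ⟩
    κ * s′ * Q + nₛ * (h * s)                 ∎)
    where open ≡-Reasoning

  M₀≡n₀ : .{{_ : NonZero (h * s)}} → + (κ * (s ∸ 1) * Q) ℚ./ (h * s) ≡ fromℕ n₀
  M₀≡n₀ = [n*d]/d≡n n₀ (h * s) (cong +_ (sym n₀*[h*s]≡κ*[s∸1]*Q))

  M₁≡n₁ : .{{_ : NonZero h}} → ((+ h ℤ.- + κ) ℤ.* (+ Q ℤ.- + 1)) ℚ./ h ≡ fromℕ n₁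
  M₁≡n₁ = [n*d]/d≡n n₁ h (trans
    (cong ((+ h ℤ.- + κ) ℤ.*_) (m+n≡o⇒o-n≡m q′ 1 (trans (ℕ.+-comm q′ 1) 1+q′≡Q)))
    ([m-n]*k≡o h κ q′ n₁*h+κ*[Q∸1]≡h*[Q∸1]))

  κ*[Q-s]≡nₛ*[h*s] : + κ ℤ.* (+ Q ℤ.- + s) ≡ + (nₛ * (h * s))
  κ*[Q-s]≡nₛ*[h*s] = trans (ℤ.*-comm (+ κ) (+ Q ℤ.- + s)) ([m-n]*k≡o Q s κ
    (trans (cong (λ x → nₛ * (h * s) + x) (ℕ.*-comm s κ)) (trans nₛ*[h*s]+κ*s≡κ*Q (ℕ.*-comm κ Q))))

  Mₛ≡nₛ : .{{_ : NonZero (h * s)}} → (+ κ ℤ.* (+ Q ℤ.- + s)) ℚ./ (h * s) ≡ fromℕ nₛ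
  Mₛ≡nₛ = [n*d]/d≡n nₛ (h * s) κ*[Q-s]≡nₛ*[h*s]

  -- For the moments: one factor s of s^a is absorbed here, which removes s from the denominator of
  -- `Mₛ` and leaves s^(a-1).
  κ*[Q-s]/h≡nₛ*s : .{{_ : NonZero h}} → (+ κ ℤ.* (+ Q ℤ.- + s)) ℚ./ h ≡ fromℕ (nₛ * s)
  κ*[Q-s]/h≡nₛ*s = [n*d]/d≡n (nₛ * s) h (trans κ*[Q-s]≡nₛ*[h*s]
    (cong +_ (solve 3 (λ n h s → n :* (h :* s) := n :* s :* h) refl nₛ h s)))

-- The enumerator, the size of the image and the moments

corollary5p1 : ∀ {c ℓ} (p e h m : ℕ) (p-prime : Prime p) (1≤e : 1 ≤ e) (1≤h : 1 ≤ h)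
    (h∣pᵉ-1 : h ∣ p ^ e ∸ 1) → 1 ≤ m → (F : FiniteField c ℓ (p ^ m)) →
    let open Parameters p e h m p-prime 1≤e 1≤h h∣pᵉ-1
        open Fibres F
    in
      (𝓔 ≈ᴾ 1ℚ ·Z^ (1 + ρ) +ᴾ M₀ ·Z^ 0 +ᴾ M₁ ·Z^ 1 +ᴾ Mₛ ·Z^ s)
    × (fromℕ (# inImage?) ≡ fromℕ Q ℚ.- M₀)
    × (fromℕ Q ℚ.- M₀ ≡ fromℕ Q ℚ.* (1ℚ ℚ.- ℚ._/_ (+ (κ * (s ∸ 1))) (h * s) {{hs≢0}}))
    × (∀ a → 1 ≤ a →
         fromℕ (sum (map (λ t → r t ^ a) elements))
           ≡ fromℕ ((1 + ρ) ^ a)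
             ℚ.+ M₁
             ℚ.+ fromℕ (s ^ (a ∸ 1)) ℚ.* ℚ._/_ (+ κ ℤ.* (+ Q ℤ.- + s)) h {{h≢0}})
corollary5p1 p e h m p-prime 1≤e 1≤h h∣pᵉ-1 _ F =
  enumerator , image-size , factor-Q , moments
  where
  open Parameters p e h m p-prime 1≤e 1≤h h∣pᵉ-1
  open Fibres F
  open FibreSizes p e h m p-prime 1≤e 1≤h h∣pᵉ-1 F
    using (#missed; #single; #full; ρ*h≡κ*[s∸1]; points-counted; twistedRoots-counted; arguments-counted;
           ∑-r; #image)
  open Counting F using (∑; sum-elements)
  open FibreCounts {h} {κ} {ρ} {s} {Q} {#missed} {#single} {#full} 1<s ρ*h≡κ*[s∸1]
    points-counted twistedRoots-counted arguments-counted
  open ≡-Reasoning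

  M₀≡ : M₀ ≡ fromℕ #missed
  M₀≡ = M₀≡n₀ {{hs≢0}}

  M₁≡ : M₁ ≡ fromℕ #single
  M₁≡ = M₁≡n₁ {{h≢0}}

  Mₛ≡ : Mₛ ≡ fromℕ #full
  Mₛ≡ = Mₛ≡nₛ {{hs≢0}}

  -- The last summand stays inside `fromℕ` because it is regrouped in two ways: as a multiple of
  -- `Mₛ` for the enumerator, and with a factor s moved next to `#full` for the moments.
  fromℕ-∑-r : ∀ φ → fromℕ (sum (map (φ ∘ r) elements)) ≡
    fromℕ (φ (1 + ρ)) ℚ.+ M₀ ℚ.* fromℕ (φ 0) ℚ.+ M₁ ℚ.* fromℕ (φ 1) ℚ.+ fromℕ (#full * φ s)
  fromℕ-∑-r φ = begin
    fromℕ (sum (map (φ ∘ r) elements))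
      ≡⟨ cong fromℕ (trans (sum-elements (φ ∘ r)) (∑-r φ)) ⟩
    fromℕ (φ (1 + ρ) + #missed * φ 0 + #single * φ 1 + #full * φ s)
      ≡⟨ fromℕ-+ (φ (1 + ρ) + #missed * φ 0 + #single * φ 1) (#full * φ s) ⟩
    fromℕ (φ (1 + ρ) + #missed * φ 0 + #single * φ 1) ℚ.+ fromℕ (#full * φ s)
      ≡⟨ cong (ℚ._+ fromℕ (#full * φ s)) (fromℕ-+ (φ (1 + ρ) + #missed * φ 0) (#single * φ 1)) ⟩
    fromℕ (φ (1 + ρ) + #missed * φ 0) ℚ.+ fromℕ (#single * φ 1) ℚ.+ fromℕ (#full * φ s)
      ≡⟨ cong₂ (λ x y → x ℚ.+ y ℚ.+ fromℕ (#full * φ s))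
           (trans (fromℕ-+ (φ (1 + ρ)) (#missed * φ 0)) (cong (fromℕ (φ (1 + ρ)) ℚ.+_) (fromℕ-* #missed (φ 0))))
           (fromℕ-* #single (φ 1)) ⟩
    fromℕ (φ (1 + ρ)) ℚ.+ fromℕ #missed ℚ.* fromℕ (φ 0) ℚ.+ fromℕ #single ℚ.* fromℕ (φ 1)
      ℚ.+ fromℕ (#full * φ s)
      ≡⟨ cong₂ (λ x y → fromℕ (φ (1 + ρ)) ℚ.+ x ℚ.* fromℕ (φ 0) ℚ.+ y ℚ.* fromℕ (φ 1) ℚ.+ fromℕ (#full * φ s)) M₀≡ M₁≡ ⟨
    fromℕ (φ (1 + ρ)) ℚ.+ M₀ ℚ.* fromℕ (φ 0) ℚ.+ M₁ ℚ.* fromℕ (φ 1) ℚ.+ fromℕ (#full * φ s) ∎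

  enumerator : 𝓔 ≈ᴾ 1ℚ ·Z^ (1 + ρ) +ᴾ M₀ ·Z^ 0 +ᴾ M₁ ·Z^ 1 +ᴾ Mₛ ·Z^ s
  enumerator k = begin
    coeff 𝓔 k
      ≡⟨ coeff-enumerator r elements k ⟩
    fromℕ (sum (map (λ t → δ (r t)) elements))
      ≡⟨ fromℕ-∑-r δ ⟩
    fromℕ (δ (1 + ρ)) ℚ.+ M₀ ℚ.* fromℕ (δ 0) ℚ.+ M₁ ℚ.* fromℕ (δ 1) ℚ.+ fromℕ (#full * δ s)
      ≡⟨ cong₂ ℚ._+_ (cong₂ ℚ._+_ (cong₂ ℚ._+_
           (trans (coeff-·Z^ 1ℚ (1 + ρ) k) (ℚ.*-identityˡ (fromℕ (δ (1 + ρ)))))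
           (coeff-·Z^ M₀ 0 k)) (coeff-·Z^ M₁ 1 k))
           (trans (coeff-·Z^ Mₛ s k) (trans (cong (ℚ._* fromℕ (δ s)) Mₛ≡) (sym (fromℕ-* #full (δ s))))) ⟨
    coeff f₁ k ℚ.+ coeff f₂ k ℚ.+ coeff f₃ k ℚ.+ coeff f₄ k
      ≡⟨ cong (λ x → x ℚ.+ coeff f₃ k ℚ.+ coeff f₄ k) (coeff-+ᴾ f₁ f₂ k) ⟨
    coeff (f₁ +ᴾ f₂) k ℚ.+ coeff f₃ k ℚ.+ coeff f₄ k
      ≡⟨ cong (ℚ._+ coeff f₄ k) (coeff-+ᴾ (f₁ +ᴾ f₂) f₃ k) ⟨
    coeff (f₁ +ᴾ f₂ +ᴾ f₃) k ℚ.+ coeff f₄ k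
      ≡⟨ coeff-+ᴾ (f₁ +ᴾ f₂ +ᴾ f₃) f₄ k ⟨
    coeff (f₁ +ᴾ f₂ +ᴾ f₃ +ᴾ f₄) k ∎
    where
    δ : ℕ → ℕ
    δ n = ind (n ℕ.≟ k)
    f₁ f₂ f₃ f₄ : Poly
    f₁ = 1ℚ ·Z^ (1 + ρ)
    f₂ = M₀ ·Z^ 0
    f₃ = M₁ ·Z^ 1
    f₄ = Mₛ ·Z^ s

  image-size : fromℕ (# inImage?) ≡ fromℕ Q ℚ.- M₀
  image-size = x+y≡z⇒x≡z-y {fromℕ (# inImage?)} {M₀} (begin
    fromℕ (# inImage?) ℚ.+ M₀                 ≡⟨ cong₂ (λ x y → fromℕ x ℚ.+ y) #image M₀≡ ⟩
    fromℕ (1 + #single + #full) ℚ.+ fromℕ #missed ≡⟨ fromℕ-+ (1 + #single + #full) #missed ⟨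
    fromℕ (1 + #single + #full + #missed)
      ≡⟨ cong fromℕ (solve 3 (λ x y z → con 1 :+ y :+ z :+ x := con 1 :+ x :+ y :+ z) refl #missed #single #full) ⟩
    fromℕ (1 + #missed + #single + #full)     ≡⟨ cong fromℕ points-counted ⟩
    fromℕ Q                                   ∎)
    where open +-*-Solver using (solve; _:+_; _:=_; con)

  factor-Q : fromℕ Q ℚ.- M₀ ≡ fromℕ Q ℚ.* (1ℚ ℚ.- ℚ._/_ (+ (κ * (s ∸ 1))) (h * s) {{hs≢0}})
  factor-Q = begin
    fromℕ Q ℚ.- M₀
      ≡⟨ cong₂ ℚ._-_ (sym (ℚ.*-identityʳ (fromℕ Q))) ([m*n]/d≡n*[m/d] (κ * (s ∸ 1)) Q (h * s) {{hs≢0}}) ⟩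
    fromℕ Q ℚ.* 1ℚ ℚ.- fromℕ Q ℚ.* x      ≡⟨ cong (fromℕ Q ℚ.* 1ℚ ℚ.+_) (ℚ.neg-distribʳ-* (fromℕ Q) x) ⟩
    fromℕ Q ℚ.* 1ℚ ℚ.+ fromℕ Q ℚ.* ℚ.- x  ≡⟨ ℚ.*-distribˡ-+ (fromℕ Q) 1ℚ (ℚ.- x) ⟨
    fromℕ Q ℚ.* (1ℚ ℚ.- x)                ∎
    where
    x : ℚ
    x = ℚ._/_ (+ (κ * (s ∸ 1))) (h * s) {{hs≢0}}

  moments : ∀ a → 1 ≤ a → fromℕ (sum (map (λ t → r t ^ a) elements)) ≡
    fromℕ ((1 + ρ) ^ a) ℚ.+ M₁ ℚ.+ fromℕ (s ^ (a ∸ 1)) ℚ.* ℚ._/_ (+ κ ℤ.* (+ Q ℤ.- + s)) h {{h≢0}}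
  moments (suc a) _ = begin
    fromℕ (sum (map (λ t → r t ^ suc a) elements))
      ≡⟨ fromℕ-∑-r (_^ suc a) ⟩
    -- The exponent is positive, so `0 ^ suc a` reduces to 0 and the missed points drop out.
    x ℚ.+ M₀ ℚ.* fromℕ 0 ℚ.+ M₁ ℚ.* fromℕ (1 ^ suc a) ℚ.+ fromℕ (#full * (s * s ^ a))
      ≡⟨ cong₂ ℚ._+_ (cong₂ ℚ._+_ (trans (cong (x ℚ.+_) (ℚ.*-zeroʳ M₀)) (ℚ.+-identityʳ x))
           (trans (cong (λ n → M₁ ℚ.* fromℕ n) (ℕ.^-zeroˡ (suc a))) (ℚ.*-identityʳ M₁)))
           (trans (cong fromℕ (trans (sym (ℕ.*-assoc #full s (s ^ a))) (ℕ.*-comm (#full * s) (s ^ a))))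
             (trans (fromℕ-* (s ^ a) (#full * s))
               (cong (fromℕ (s ^ a) ℚ.*_) (sym (κ*[Q-s]/h≡nₛ*s {{h≢0}}))))) ⟩
    x ℚ.+ M₁ ℚ.+ fromℕ (s ^ a) ℚ.* ℚ._/_ (+ κ ℤ.* (+ Q ℤ.- + s)) h {{h≢0}} ∎
    where
    x : ℚ
    x = fromℕ ((1 + ρ) ^ suc a)
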